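{- Let $\mathbf A$ be a semisimple Pavelka algebra and $O\colon A\to A$ a closure operator. The following are equivalent: (i) $\mathbf r\cdot O(x)\le O(\mathbf r\cdot x)$ for all $x\in A$ and all constants $\mathbf r$; (ii) there exist a set $G$ and a fuzzy relation $I\colon\mathrm{Spec_M}\mathbf A\times G\to[0,1]$ (a fuzzy formal context $(\mathrm{Spec_M}\mathbf A,G,I)$) such that $n_{\mathbf A}(O(x))=h_I(d_I(n_{\mathbf A}(x)))$ for all $x\in A$.
   Context: An MV-algebra $(A;\oplus,\neg,0)$ carries derived operations $1=\neg0$, $x\cdot y=\neg(\neg x\oplus\neg y)$, $x\rightarrow y=\neg x\oplus y$, order $x\le y$ iff $\neg x\oplus y=1$. The standard MV-algebra is $[0,1]$ with $x\oplus y=\min\{x+y,1\}$, $\neg x=1-x$ (so $x\cdot y=\max\{0,x+y-1\}$, $x\rightarrow y=\min\{1,1-x+y\}$). A Pavelka algebra is $\mathbf A=(A;\oplus,\neg,\{\mathbf r\mid r\in[0,1]\cap\mathbb Q\})$ with $(A;\oplus,\neg,\mathbf 0)$ an MV-algebra, $\mathbf r\oplus\mathbf s=\mathbf t$ whenever $\min\{r+s,1\}=t$, $\neg\mathbf r=\mathbf s$ whenever $1-r=s$. Filters are filters of the MV-reduct; $\mathrm{Spec_M}\mathbf A$ is the set of maximal proper filters; for $F\in\mathrm{Spec_M}\mathbf A$, $\mathbf A/F$ embeds uniquely into $[0,1]$ and $x/F$ is identified with its image in $[0,1]$. Semisimple: MV-reduct is a subdirect product of simple MV-algebras. Natural embedding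 $n_{\mathbf A}\colon A\to[0,1]^{\mathrm{Spec_M}\mathbf A}$, $n_{\mathbf A}(x)(F)=x/F$. A closure operator is a monotone $O$ with $x\le O(x)$, $O(O(x))=O(x)$. For $I\colon M\times G\to[0,1]$ (with $M=\mathrm{Spec_M}\mathbf A$): $d_I\colon[0,1]^M\to[0,1]^G$, $d_I(x)(g)=\bigwedge_{m\in M}(x(m)\rightarrow I(m,g))$; $h_I\colon[0,1]^G\to[0,1]^M$, $h_I(y)(m)=\bigwedge_{g\in G}(y(g)\rightarrow I(m,g))$. -}

module Defs where

open import Algebra.Structures using (IsCommutativeMonoid)
open import Axiom.ExcludedMiddle using (ExcludedMiddle)
open import Data.Empty using (⊥-elim)
open import Data.Integer as ℤ using (+_; -[1+_])
import Data.Integer.Properties as ℤP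
open import Data.Nat as ℕ using (ℕ; zero; suc)
import Data.Nat.Properties as ℕP
open import Data.Nat.Coprimality using (Coprime)
open import Data.Product using (Σ-syntax; ∃-syntax; _×_; _,_; proj₁; proj₂)
open import Data.Rational as ℚ using (ℚ; mkℚ; 0ℚ; 1ℚ; _<_; _+_; _-_; _⊓_)
import Data.Rational.Properties as ℚP
open import Data.Rational.Solver using (module +-*-Solver)
import Data.Rational.Unnormalised as ℚᵘ
import Data.Rational.Unnormalised.Properties as ℚᵘP
import Data.Integer.Solver as ℤS
open import Data.Sum using (_⊎_; inj₁; inj₂)
open import Function.Definitions using (Injective; Surjective)
open import Level using (Level; _⊔_; Lift; lift; lower) renaming (suc to lsuc)
open import Relation.Binary using (Rel; IsEquivalence)
open import Relation.Binary.PropositionalEquality using (_≡_; refl; sym; trans; cong; subst)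
import Relation.Binary.Reasoning.Setoid as SetoidReasoning
open import Relation.Nullary using (¬_; yes; no)
open import Relation.Nullary.Decidable using () renaming (map′ to Dec-map′)
open import Relation.Unary using (Pred; _∈_; _∉_; _⊆_)

record ℚ[0,1] : Set where
  constructor ⟪_,_,_⟫
  field
    value : ℚ
    0≤value : 0ℚ ℚ.≤ value
    value≤1 : value ℚ.≤ 1ℚ

open ℚ[0,1] public

0ᵘ : ℚ[0,1]
0ᵘ = ⟪ 0ℚ , ℚP.≤-refl , ℚP.<⇒≤ (ℚP.positive⁻¹ 1ℚ) ⟫

1ᵘ : ℚ[0,1]
1ᵘ = ⟪ 1ℚ , ℚP.<⇒≤ (ℚP.positive⁻¹ 1ℚ) , ℚP.≤-refl ⟫

record RawMVAlgebra (c ℓ : Level) : Set (lsuc (c ⊔ ℓ)) where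
  infix  8 ~_
  infixl 7 _·_
  infixl 6 _⊕_
  infixr 5 _⇒_
  infix  4 _≈_ _≤_
  field
    Carrier : Set c
    _≈_     : Rel Carrier ℓ
    _⊕_     : Carrier → Carrier → Carrier
    ~_      : Carrier → Carrier
    0#      : Carrier

  1# : Carrier
  1# = ~ 0#

  _·_ : Carrier → Carrier → Carrier
  x · y = ~ (~ x ⊕ ~ y)

  _⇒_ : Carrier → Carrier → Carrier
  x ⇒ y = ~ x ⊕ y

  _≤_ : Rel Carrier ℓ
  x ≤ y = ~ x ⊕ y ≈ 1#

record IsMVAlgebra {c ℓ} (A : RawMVAlgebra c ℓ) : Set (c ⊔ ℓ) where
  open RawMVAlgebra A
  field
    ⊕-isCommutativeMonoid : IsCommutativeMonoid _≈_ _⊕_ 0#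
    ~-cong                : ∀ {x y} → x ≈ y → ~ x ≈ ~ y
    ~-involutive          : ∀ x → ~ ~ x ≈ x
    ⊕-zeroʳ               : ∀ x → x ⊕ 1# ≈ 1#
    łukasiewicz           : ∀ x y → ~ (~ x ⊕ y) ⊕ y ≈ ~ (~ y ⊕ x) ⊕ x

record MVAlgebra (c ℓ : Level) : Set (lsuc (c ⊔ ℓ)) where
  field
    raw         : RawMVAlgebra c ℓ
    isMVAlgebra : IsMVAlgebra raw
  open RawMVAlgebra raw public
  open IsMVAlgebra isMVAlgebra public

record RawPavelkaAlgebra (c ℓ : Level) : Set (lsuc (c ⊔ ℓ)) where
  infix  8 ~_
  infixl 6 _⊕_
  infix  4 _≈_
  field
    Carrier : Set c
    _≈_     : Rel Carrier ℓ
    _⊕_     : Carrier → Carrier → Carrier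
    ~_      : Carrier → Carrier
    const   : ℚ[0,1] → Carrier

  mvRaw : RawMVAlgebra c ℓ
  mvRaw = record { Carrier = Carrier ; _≈_ = _≈_ ; _⊕_ = _⊕_ ; ~_ = ~_ ; 0# = const 0ᵘ }

  open RawMVAlgebra mvRaw public using (0#; 1#; _·_; _⇒_; _≤_)

record IsPavelkaAlgebra {c ℓ} (A : RawPavelkaAlgebra c ℓ) : Set (c ⊔ ℓ) where
  open RawPavelkaAlgebra A
  field
    isMVAlgebra : IsMVAlgebra mvRaw
    const-⊕     : ∀ r s t → (value r + value s) ⊓ 1ℚ ≡ value t → const r ⊕ const s ≈ const t
    const-~     : ∀ r s → 1ℚ - value r ≡ value s → ~ const r ≈ const s

record PavelkaAlgebra (c ℓ : Level) : Set (lsuc (c ⊔ ℓ)) where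
  field
    raw              : RawPavelkaAlgebra c ℓ
    isPavelkaAlgebra : IsPavelkaAlgebra raw
  open RawPavelkaAlgebra raw public
  open IsPavelkaAlgebra isPavelkaAlgebra public
  open IsMVAlgebra isMVAlgebra public

  reduct : MVAlgebra c ℓ
  reduct = record { raw = mvRaw ; isMVAlgebra = isMVAlgebra }

record IsMVHomomorphism {c ℓ c′ ℓ′} (A : RawMVAlgebra c ℓ) (B : RawMVAlgebra c′ ℓ′)
    (f : RawMVAlgebra.Carrier A → RawMVAlgebra.Carrier B) : Set (c ⊔ ℓ ⊔ ℓ′) where
  private
    module A = RawMVAlgebra A
    module B = RawMVAlgebra B
  field
    ⟦⟧-cong : ∀ {x y} → x A.≈ y → f x B.≈ f y
    ⊕-homo  : ∀ x y → f (x A.⊕ y) B.≈ f x B.⊕ f y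
    ~-homo  : ∀ x → f (A.~ x) B.≈ B.~ f x
    0#-homo : f A.0# B.≈ B.0#

record IsPavelkaEmbedding {c ℓ c′ ℓ′} (A : RawPavelkaAlgebra c ℓ) (B : RawPavelkaAlgebra c′ ℓ′)
    (f : RawPavelkaAlgebra.Carrier A → RawPavelkaAlgebra.Carrier B) : Set (c ⊔ ℓ ⊔ ℓ′) where
  private
    module A = RawPavelkaAlgebra A
    module B = RawPavelkaAlgebra B
  field
    isMVHomomorphism : IsMVHomomorphism A.mvRaw B.mvRaw f
    const-homo       : ∀ r → f (A.const r) B.≈ B.const r
    injective        : Injective A._≈_ B._≈_ f
  open IsMVHomomorphism isMVHomomorphism public

record IsMVCongruence {c ℓ p} (A : MVAlgebra c ℓ) (θ : Rel (MVAlgebra.Carrier A) p) : Set (c ⊔ ℓ ⊔ p) where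
  open MVAlgebra A
  field
    isEquivalence : IsEquivalence θ
    reflexive     : ∀ {x y} → x ≈ y → θ x y
    ⊕-compatible  : ∀ {x x′ y y′} → θ x x′ → θ y y′ → θ (x ⊕ y) (x′ ⊕ y′)
    ~-compatible  : ∀ {x x′} → θ x x′ → θ (~ x) (~ x′)

record IsSimple {c ℓ} (A : MVAlgebra c ℓ) : Set (lsuc (c ⊔ ℓ)) where
  open MVAlgebra A
  field
    nontrivial  : ∃[ x ] ∃[ y ] ¬ x ≈ y
    congruences : ∀ (θ : Rel Carrier (c ⊔ ℓ)) → IsMVCongruence A θ →
                  (∀ x y → θ x y → x ≈ y) ⊎ (∀ x y → θ x y)

record SubdirectSimple {c ℓ} (A : MVAlgebra c ℓ) : Set (lsuc (lsuc (c ⊔ ℓ))) where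
  private module A = MVAlgebra A
  field
    J            : Set (lsuc (c ⊔ ℓ))
    B            : J → MVAlgebra c (c ⊔ ℓ)
    simple       : ∀ j → IsSimple (B j)
    π            : ∀ j → A.Carrier → MVAlgebra.Carrier (B j)
    homomorphism : ∀ j → IsMVHomomorphism A.raw (MVAlgebra.raw (B j)) (π j)
    surjective   : ∀ j → Surjective A._≈_ (MVAlgebra._≈_ (B j)) (π j)
    injective    : ∀ x y → (∀ j → MVAlgebra._≈_ (B j) (π j x) (π j y)) → x A.≈ y

Semisimple : ∀ {c ℓ} → PavelkaAlgebra c ℓ → Set (lsuc (lsuc (c ⊔ ℓ)))
Semisimple A = SubdirectSimple (PavelkaAlgebra.reduct A)

record IsFilter {c ℓ p} (A : MVAlgebra c ℓ) (F : Pred (MVAlgebra.Carrier A) p) : Set (c ⊔ ℓ ⊔ p) where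
  open MVAlgebra A
  field
    1∈       : 1# ∈ F
    ·-closed : ∀ {x y} → x ∈ F → y ∈ F → x · y ∈ F
    up       : ∀ {x y} → x ≤ y → x ∈ F → y ∈ F

Proper : ∀ {a p} {A : Set a} → Pred A p → Set (a ⊔ p)
Proper F = ¬ (∀ x → x ∈ F)

record MaximalFilter {c ℓ} (A : MVAlgebra c ℓ) : Set (lsuc (c ⊔ ℓ)) where
  open MVAlgebra A
  field
    filter   : Pred Carrier (c ⊔ ℓ)
    isFilter : IsFilter A filter
    proper   : Proper filter
    maximal  : ∀ (G : Pred Carrier (c ⊔ ℓ)) → IsFilter A G → Proper G → filter ⊆ G → G ⊆ filter
  open IsFilter isFilter public

SpecM : ∀ {c ℓ} → PavelkaAlgebra c ℓ → Set (lsuc (c ⊔ ℓ))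
SpecM A = MaximalFilter (PavelkaAlgebra.reduct A)

record IsClosureOperator {c ℓ} (A : PavelkaAlgebra c ℓ)
    (O : PavelkaAlgebra.Carrier A → PavelkaAlgebra.Carrier A) : Set (c ⊔ ℓ) where
  open PavelkaAlgebra A
  field
    monotone   : ∀ {x y} → x ≤ y → O x ≤ O y
    extensive  : ∀ x → x ≤ O x
    idempotent : ∀ x → O (O x) ≈ O x

module MVProperties {c ℓ} (A : MVAlgebra c ℓ) where
  open MVAlgebra A
  open IsCommutativeMonoid ⊕-isCommutativeMonoid public
    using (isEquivalence; assoc; comm; identityˡ; identityʳ; setoid)
    renaming (∙-cong to ⊕-cong; refl to ≈-refl; sym to ≈-sym; trans to ≈-trans)
  open SetoidReasoning setoid

  ~1≈0 : ~ 1# ≈ 0#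
  ~1≈0 = ~-involutive 0#

  ⊕-zeroˡ : ∀ x → 1# ⊕ x ≈ 1#
  ⊕-zeroˡ x = ≈-trans (comm _ _) (⊕-zeroʳ x)

  complementˡ : ∀ x → ~ x ⊕ x ≈ 1#
  complementˡ x = begin
    ~ x ⊕ x                ≈⟨ ⊕-cong (~-cong (identityˡ x)) ≈-refl ⟨
    ~ (0# ⊕ x) ⊕ x         ≈⟨ ⊕-cong (~-cong (⊕-cong ~1≈0 ≈-refl)) ≈-refl ⟨
    ~ (~ 1# ⊕ x) ⊕ x       ≈⟨ łukasiewicz 1# x ⟩
    ~ (~ x ⊕ 1#) ⊕ 1#      ≈⟨ ⊕-zeroʳ _ ⟩
    1#                     ∎

  ≤-reflexive : ∀ {x y} → x ≈ y → x ≤ y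
  ≤-reflexive p = ≈-trans (⊕-cong ≈-refl (≈-sym p)) (complementˡ _)

  ≤-refl : ∀ {x} → x ≤ x
  ≤-refl = complementˡ _

  ≤⇒⊕ : ∀ {x y} → x ≤ y → ∃[ u ] y ≈ x ⊕ u
  ≤⇒⊕ {x} {y} x≤y = _ , (begin
    y                      ≈⟨ identityˡ y ⟨
    0# ⊕ y                 ≈⟨ ⊕-cong ~1≈0 ≈-refl ⟨
    ~ 1# ⊕ y               ≈⟨ ⊕-cong (~-cong x≤y) ≈-refl ⟨
    ~ (~ x ⊕ y) ⊕ y        ≈⟨ łukasiewicz x y ⟩
    ~ (~ y ⊕ x) ⊕ x        ≈⟨ comm _ _ ⟩
    x ⊕ ~ (~ y ⊕ x)        ∎)

  ⊕⇒≤ : ∀ {x y} u → y ≈ x ⊕ u → x ≤ y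
  ⊕⇒≤ {x} {y} u p = begin
    ~ x ⊕ y                ≈⟨ ⊕-cong ≈-refl p ⟩
    ~ x ⊕ (x ⊕ u)          ≈⟨ assoc _ _ _ ⟨
    (~ x ⊕ x) ⊕ u          ≈⟨ ⊕-cong (complementˡ x) ≈-refl ⟩
    1# ⊕ u                 ≈⟨ ⊕-zeroˡ u ⟩
    1#                     ∎

  ≤-trans : ∀ {x y z} → x ≤ y → y ≤ z → x ≤ z
  ≤-trans x≤y y≤z with ≤⇒⊕ x≤y | ≤⇒⊕ y≤z
  ... | u , p | v , q = ⊕⇒≤ (u ⊕ v) (≈-trans q (≈-trans (⊕-cong p ≈-refl) (assoc _ _ _)))

  ≤-antisym : ∀ {x y} → x ≤ y → y ≤ x → x ≈ y
  ≤-antisym {x} {y} x≤y y≤x = begin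
    x                      ≈⟨ identityˡ x ⟨
    0# ⊕ x                 ≈⟨ ⊕-cong ~1≈0 ≈-refl ⟨
    ~ 1# ⊕ x               ≈⟨ ⊕-cong (~-cong y≤x) ≈-refl ⟨
    ~ (~ y ⊕ x) ⊕ x        ≈⟨ łukasiewicz y x ⟩
    ~ (~ x ⊕ y) ⊕ y        ≈⟨ ⊕-cong (~-cong x≤y) ≈-refl ⟩
    ~ 1# ⊕ y               ≈⟨ ⊕-cong ~1≈0 ≈-refl ⟩
    0# ⊕ y                 ≈⟨ identityˡ y ⟩
    y                      ∎

  ≤-1 : ∀ x → x ≤ 1#
  ≤-1 x = ⊕-zeroʳ _

  0-≤ : ∀ x → 0# ≤ x
  0-≤ x = ⊕-zeroˡ x

  x≤x⊕y : ∀ x y → x ≤ x ⊕ y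
  x≤x⊕y x y = ⊕⇒≤ y ≈-refl

  y≤x⊕y : ∀ x y → y ≤ x ⊕ y
  y≤x⊕y x y = ⊕⇒≤ x (comm x y)

  ⊕-monoˡ : ∀ {x y} z → x ≤ y → x ⊕ z ≤ y ⊕ z
  ⊕-monoˡ {x} {y} z x≤y with ≤⇒⊕ x≤y
  ... | u , p = ⊕⇒≤ u (begin
    y ⊕ z                  ≈⟨ ⊕-cong p ≈-refl ⟩
    (x ⊕ u) ⊕ z            ≈⟨ assoc _ _ _ ⟩
    x ⊕ (u ⊕ z)            ≈⟨ ⊕-cong ≈-refl (comm u z) ⟩
    x ⊕ (z ⊕ u)            ≈⟨ assoc _ _ _ ⟨
    (x ⊕ z) ⊕ u            ∎)

  ⊕-mono : ∀ {x y z w} → x ≤ y → z ≤ w → x ⊕ z ≤ y ⊕ w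
  ⊕-mono {x} {y} {z} {w} p q = ≤-trans (⊕-monoˡ z p)
    (≤-trans (≤-reflexive (comm y z)) (≤-trans (⊕-monoˡ y q) (≤-reflexive (comm w y))))

  contrapositive : ∀ x y → x ⇒ y ≈ ~ y ⇒ ~ x
  contrapositive x y = ≈-trans (comm _ _) (⊕-cong (≈-sym (~-involutive y)) ≈-refl)

  ~-antitone : ∀ {x y} → x ≤ y → ~ y ≤ ~ x
  ~-antitone p = ≈-trans (≈-sym (contrapositive _ _)) p

  ·-cong : ∀ {x x′ y y′} → x ≈ x′ → y ≈ y′ → x · y ≈ x′ · y′
  ·-cong p q = ~-cong (⊕-cong (~-cong p) (~-cong q))

  ·-comm : ∀ x y → x · y ≈ y · x
  ·-comm x y = ~-cong (comm _ _)

  ·-assoc : ∀ x y z → (x · y) · z ≈ x · (y · z)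
  ·-assoc x y z = ~-cong (begin
    ~ ~ (~ x ⊕ ~ y) ⊕ ~ z  ≈⟨ ⊕-cong (~-involutive _) ≈-refl ⟩
    (~ x ⊕ ~ y) ⊕ ~ z      ≈⟨ assoc _ _ _ ⟩
    ~ x ⊕ (~ y ⊕ ~ z)      ≈⟨ ⊕-cong ≈-refl (~-involutive _) ⟨
    ~ x ⊕ ~ ~ (~ y ⊕ ~ z)  ∎)

  ·-mono : ∀ {x y z w} → x ≤ y → z ≤ w → x · z ≤ y · w
  ·-mono p q = ~-antitone (⊕-mono (~-antitone p) (~-antitone q))

  ·-identityʳ : ∀ x → x · 1# ≈ x
  ·-identityʳ x = ≈-trans (~-cong (≈-trans (⊕-cong ≈-refl ~1≈0) (identityʳ _))) (~-involutive x)

  ·-identityˡ : ∀ x → 1# · x ≈ x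
  ·-identityˡ x = ≈-trans (·-comm _ _) (·-identityʳ x)

  ·-complement : ∀ x → x · ~ x ≈ 0#
  ·-complement x = ≈-trans (~-cong (≈-trans (comm _ _) (complementˡ (~ x)))) ~1≈0

  x·y≤x : ∀ x y → x · y ≤ x
  x·y≤x x y = ≤-trans (·-mono ≤-refl (≤-1 y)) (≤-reflexive (·-identityʳ x))

  curry-≈ : ∀ x y z → (x · y) ⇒ z ≈ x ⇒ (y ⇒ z)
  curry-≈ x y z = ≈-trans (⊕-cong (~-involutive _) ≈-refl) (assoc _ _ _)

  residual : ∀ {x y z} → x · y ≤ z → x ≤ y ⇒ z
  residual p = ≈-trans (≈-sym (curry-≈ _ _ _)) p

  unresidual : ∀ {x y z} → x ≤ y ⇒ z → x · y ≤ z
  unresidual p = ≈-trans (curry-≈ _ _ _) p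

  modusPonens : ∀ x y → x · (x ⇒ y) ≤ y
  modusPonens x y = ≤-trans (≤-reflexive (·-comm _ _)) (unresidual ≤-refl)

  ⇒-trans : ∀ x y z → (x ⇒ y) · (y ⇒ z) ≤ x ⇒ z
  ⇒-trans x y z = residual (≤-trans (≤-reflexive
    (≈-trans (·-comm _ _) (≈-sym (·-assoc _ _ _))))
    (≤-trans (·-mono (modusPonens x y) ≤-refl) (modusPonens y z)))

  ⇒-⊕ : ∀ x y z → x ⇒ y ≤ (x ⊕ z) ⇒ (y ⊕ z)
  ⇒-⊕ x y z = ≤-trans (⊕-mono lem ≤-refl) (≤-reflexive (begin
    (~ (x ⊕ z) ⊕ z) ⊕ y    ≈⟨ assoc _ _ _ ⟩
    ~ (x ⊕ z) ⊕ (z ⊕ y)    ≈⟨ ⊕-cong ≈-refl (comm z y) ⟩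
    ~ (x ⊕ z) ⊕ (y ⊕ z)    ∎))
    where
    lem : ~ x ≤ ~ (x ⊕ z) ⊕ z
    lem = ≤-trans (y≤x⊕y (~ (~ z ⊕ ~ x)) (~ x)) (≤-reflexive (begin
      ~ (~ z ⊕ ~ x) ⊕ ~ x    ≈⟨ łukasiewicz z (~ x) ⟩
      ~ (~ ~ x ⊕ z) ⊕ z      ≈⟨ ⊕-cong (~-cong (⊕-cong (~-involutive x) ≈-refl)) ≈-refl ⟩
      ~ (x ⊕ z) ⊕ z          ∎))

  ∧-comm : ∀ x y → x · (x ⇒ y) ≈ y · (y ⇒ x)
  ∧-comm x y = ~-cong (begin
    ~ x ⊕ ~ (~ x ⊕ y)        ≈⟨ comm _ _ ⟩
    ~ (~ x ⊕ y) ⊕ ~ x        ≈⟨ ⊕-cong (~-cong (≈-trans (⊕-cong (~-involutive y) ≈-refl) (comm _ _))) ≈-refl ⟨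
    ~ (~ ~ y ⊕ ~ x) ⊕ ~ x    ≈⟨ łukasiewicz (~ y) (~ x) ⟩
    ~ (~ ~ x ⊕ ~ y) ⊕ ~ y    ≈⟨ ⊕-cong (~-cong (≈-trans (⊕-cong (~-involutive x) ≈-refl) (comm _ _))) ≈-refl ⟩
    ~ (~ y ⊕ x) ⊕ ~ y        ≈⟨ comm _ _ ⟩
    ~ y ⊕ ~ (~ y ⊕ x)        ∎)

  ≤0⇒≤ : ∀ {x y} → x · ~ y ≤ 0# → x ≤ y
  ≤0⇒≤ {x} {y} p = ≤-trans (residual p) (≤-reflexive (≈-trans (identityʳ _) (~-involutive y)))

  prelinear : ∀ x y → (x ⇒ y) ⇒ (y ⇒ x) ≤ y ⇒ x
  prelinear x y = residual (≤-trans (≤-reflexive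
      (≈-trans (·-comm _ _) (·-cong ≈-refl shape))) (≤0⇒≤ main))
    where
    u = x ⇒ y
    p = x ⊕ ~ u
    shape : u ⇒ (y ⇒ x) ≈ y ⇒ p
    shape = begin
      ~ u ⊕ (~ y ⊕ x)  ≈⟨ comm _ _ ⟩
      (~ y ⊕ x) ⊕ ~ u  ≈⟨ assoc _ _ _ ⟩
      ~ y ⊕ (x ⊕ ~ u)  ∎
    step₁ : p · ~ x ≤ ~ u
    step₁ = ≤-trans (≤-reflexive (≈-trans (·-comm _ _)
      (·-cong ≈-refl (⊕-cong (≈-sym (~-involutive x)) ≈-refl)))) (modusPonens (~ x) (~ u))
    step₂ : ~ y · (p ⇒ y) ≤ ~ p
    step₂ = ≤-trans (≤-reflexive (·-cong ≈-refl (contrapositive p y))) (modusPonens (~ y) (~ p))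
    ~u : ~ u ≈ x · ~ y
    ~u = ~-cong (⊕-cong ≈-refl (≈-sym (~-involutive y)))
    ~p : ~ p ≤ ~ x
    ~p = ~-antitone (x≤x⊕y x (~ u))
    rearrange : (p · (p ⇒ y)) · ~ x ≈ (p · ~ x) · (p ⇒ y)
    rearrange = ≈-trans (·-assoc _ _ _) (≈-trans (·-cong ≈-refl (·-comm _ _)) (≈-sym (·-assoc _ _ _)))
    main : (y · (y ⇒ p)) · ~ x ≤ 0#
    main = ≤-trans (≤-reflexive (≈-trans (·-cong (∧-comm y p) ≈-refl) rearrange))
      (≤-trans (·-mono step₁ ≤-refl)
      (≤-trans (≤-reflexive (≈-trans (·-cong ~u ≈-refl) (·-assoc _ _ _)))
      (≤-trans (·-mono ≤-refl (≤-trans step₂ ~p)) (≤-reflexive (·-complement x)))))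

  infixr 8 _^_
  _^_ : Carrier → ℕ → Carrier
  x ^ zero  = 1#
  x ^ suc n = x · x ^ n

  ^-+ : ∀ x m n → x ^ (m ℕ.+ n) ≈ x ^ m · x ^ n
  ^-+ x zero    n = ≈-sym (·-identityˡ _)
  ^-+ x (suc m) n = ≈-trans (·-cong ≈-refl (^-+ x m n)) (≈-sym (·-assoc _ _ _))

  1⇒ : ∀ x → 1# ⇒ x ≈ x
  1⇒ x = ≈-trans (⊕-cong ~1≈0 ≈-refl) (identityˡ x)

  prelinear-^ : ∀ x y n → (x ⇒ y) ^ n ⇒ (y ⇒ x) ≤ y ⇒ x
  prelinear-^ x y zero    = ≤-reflexive (1⇒ _)
  prelinear-^ x y (suc n) = ≤-trans
    (≤-reflexive (≈-trans (⊕-cong (~-cong (·-comm _ _)) ≈-refl) (curry-≈ _ _ _)))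
    (≤-trans (⊕-mono ≤-refl (prelinear x y)) (prelinear-^ x y n))

Archimedean : ∀ {c ℓ} → MVAlgebra c ℓ → Set (c ⊔ ℓ)
Archimedean B = ∀ x → (x ≈ 1#) ⊎ (∃[ n ] x ^ n ≈ 0#)
  where
  open MVAlgebra B
  open MVProperties B

-- The quotient A/F: the carrier of A with equality weakened to congruence modulo F.
module Quotient {c ℓ} (A : PavelkaAlgebra c ℓ) (F : SpecM A) where
  open PavelkaAlgebra A
  open MVProperties reduct
  open MaximalFilter F

  infix 4 _≈F_
  _≈F_ : Rel Carrier (c ⊔ ℓ)
  x ≈F y = (x ⇒ y) ∈ filter × (y ⇒ x) ∈ filter

  quotientRaw : RawPavelkaAlgebra c (c ⊔ ℓ)
  quotientRaw = record { Carrier = Carrier ; _≈_ = _≈F_ ; _⊕_ = _⊕_ ; ~_ = ~_ ; const = const }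

  ≈1∈ : ∀ {x} → x ≈ 1# → x ∈ filter
  ≈1∈ p = up (≤-reflexive (≈-sym p)) 1∈

  ≈⇒≈F : ∀ {x y} → x ≈ y → x ≈F y
  ≈⇒≈F p = ≈1∈ (≤-reflexive p) , ≈1∈ (≤-reflexive (≈-sym p))

  ≈F-trans : ∀ {x y z} → x ≈F y → y ≈F z → x ≈F z
  ≈F-trans (a , b) (a′ , b′) = up (⇒-trans _ _ _) (·-closed a a′) , up (⇒-trans _ _ _) (·-closed b′ b)

  ≈F-⊕ˡ : ∀ {x y} z → x ≈F y → x ⊕ z ≈F y ⊕ z
  ≈F-⊕ˡ z (a , b) = up (⇒-⊕ _ _ z) a , up (⇒-⊕ _ _ z) b

  ∈⇒≈F1 : ∀ {x} → x ∈ filter → x ≈F 1#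
  ∈⇒≈F1 p = ≈1∈ (≤-1 _) , up (≤-reflexive (≈-sym (1⇒ _))) p

  ≈F1⇒∈ : ∀ {x} → x ≈F 1# → x ∈ filter
  ≈F1⇒∈ (_ , p) = up (≤-reflexive (1⇒ _)) p

  quotient-isMVAlgebra : IsMVAlgebra (RawPavelkaAlgebra.mvRaw quotientRaw)
  quotient-isMVAlgebra = record
    { ⊕-isCommutativeMonoid = record
      { isMonoid = record
        { isSemigroup = record
          { isMagma = record
            { isEquivalence = record
              { refl  = ≈⇒≈F ≈-refl
              ; sym   = λ (a , b) → b , a
              ; trans = ≈F-trans
              }
            ; ∙-cong = λ {x} {y} {u} {v} p q → ≈F-trans (≈F-⊕ˡ u p)
                (≈F-trans (≈⇒≈F (comm y u)) (≈F-trans (≈F-⊕ˡ y q) (≈⇒≈F (comm v y))))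
            }
          ; assoc = λ x y z → ≈⇒≈F (assoc x y z)
          }
        ; identity = (λ x → ≈⇒≈F (identityˡ x)) , (λ x → ≈⇒≈F (identityʳ x))
        }
      ; comm = λ x y → ≈⇒≈F (comm x y)
      }
    ; ~-cong       = λ (a , b) → up (≤-reflexive (contrapositive _ _)) b , up (≤-reflexive (contrapositive _ _)) a
    ; ~-involutive = λ x → ≈⇒≈F (~-involutive x)
    ; ⊕-zeroʳ      = λ x → ≈⇒≈F (⊕-zeroʳ x)
    ; łukasiewicz  = λ x y → ≈⇒≈F (łukasiewicz x y)
    }

  quotient : PavelkaAlgebra c (c ⊔ ℓ)
  quotient = record
    { raw = quotientRaw
    ; isPavelkaAlgebra = record
      { isMVAlgebra = quotient-isMVAlgebra
      ; const-⊕     = λ r s t p → ≈⇒≈F (const-⊕ r s t p)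
      ; const-~     = λ r s p → ≈⇒≈F (const-~ r s p)
      }
    }

  quotient-nontrivial : ¬ (0# ≈F 1#)
  quotient-nontrivial p = proper λ x → up (0-≤ x) (≈F1⇒∈ p)

  private
    ^-quotient : ∀ x n → MVProperties._^_ (PavelkaAlgebra.reduct quotient) x n ≡ x ^ n
    ^-quotient x zero    = refl
    ^-quotient x (suc n) = cong (x ·_) (^-quotient x n)

  quotient-archimedean : ExcludedMiddle (c ⊔ ℓ) → Archimedean (PavelkaAlgebra.reduct quotient)
  quotient-archimedean em x with em {x ∈ filter}
  ... | yes x∈F = inj₁ (∈⇒≈F1 x∈F)
  ... | no  x∉F with em {∃[ n ] ((x ^ n ⇒ 0#) ∈ filter)}
  ... | yes (n , p) = inj₂ (n , subst (_≈F 0#) (sym (^-quotient x n)) (p , ≈1∈ (0-≤ _)))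
  ... | no  ¬nilp = ⊥-elim (x∉F (maximal G G-isFilter G-proper F⊆G (1 , ≈1∈ (≤-reflexive (·-identityʳ x)))))
    where
    G : Pred Carrier (c ⊔ ℓ)
    G y = ∃[ n ] ((x ^ n ⇒ y) ∈ filter)
    F⊆G : filter ⊆ G
    F⊆G p = 0 , up (≤-reflexive (≈-sym (1⇒ _))) p
    G-proper : Proper G
    G-proper all = ¬nilp (all 0#)
    product : ∀ p q y z → (p ⇒ y) · (q ⇒ z) ≤ (p · q) ⇒ (y · z)
    product p q y z = residual (≤-trans (≤-reflexive lem) (·-mono (modusPonens p y) (modusPonens q z)))
      where
      open SetoidReasoning setoid
      lem : ((p ⇒ y) · (q ⇒ z)) · (p · q) ≈ (p · (p ⇒ y)) · (q · (q ⇒ z))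
      lem = begin
        ((p ⇒ y) · (q ⇒ z)) · (p · q)   ≈⟨ ·-comm _ _ ⟩
        (p · q) · ((p ⇒ y) · (q ⇒ z))   ≈⟨ ·-assoc _ _ _ ⟩
        p · (q · ((p ⇒ y) · (q ⇒ z)))   ≈⟨ ·-cong ≈-refl (·-cong ≈-refl (·-comm _ _)) ⟩
        p · (q · ((q ⇒ z) · (p ⇒ y)))   ≈⟨ ·-cong ≈-refl (·-assoc _ _ _) ⟨
        p · ((q · (q ⇒ z)) · (p ⇒ y))   ≈⟨ ·-cong ≈-refl (·-comm _ _) ⟩
        p · ((p ⇒ y) · (q · (q ⇒ z)))   ≈⟨ ·-assoc _ _ _ ⟨
        (p · (p ⇒ y)) · (q · (q ⇒ z))   ∎
    G-isFilter : IsFilter reduct G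
    G-isFilter = record
      { 1∈       = 0 , ≈1∈ (⊕-zeroʳ _)
      ; ·-closed = λ { (m , p) (n , q) → m ℕ.+ n ,
          up (≤-trans (product _ _ _ _) (≤-reflexive (⊕-cong (~-cong (≈-sym (^-+ x m n))) ≈-refl))) (·-closed p q) }
      ; up       = λ { y≤z (n , p) → n , up (⊕-mono ≤-refl y≤z) p }
      }

module ℚLemmas where
  open +-*-Solver
  private module Z = ℤS.+-*-Solver

  0<1 : 0ℚ < 1ℚ
  0<1 = ℚP.positive⁻¹ 1ℚ

  <-by : ∀ {p q} d → 0ℚ < d → q ≡ p + d → p < q
  <-by {p} d 0<d refl = subst (_< p + d) (ℚP.+-identityʳ p) (ℚP.+-monoʳ-< p 0<d)

  ≤-by : ∀ {p q} d → 0ℚ ℚ.≤ d → q ≡ p + d → p ℚ.≤ q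
  ≤-by {p} d 0≤d refl = subst (ℚ._≤ p + d) (ℚP.+-identityʳ p) (ℚP.+-monoʳ-≤ p 0≤d)

  0<- : ∀ {p q} → p < q → 0ℚ < q - p
  0<- {p} {q} p<q = subst (_< q - p) (ℚP.+-inverseʳ p) (ℚP.+-monoˡ-< (ℚ.- p) p<q)

  0≤- : ∀ {p q} → p ℚ.≤ q → 0ℚ ℚ.≤ q - p
  0≤- {p} {q} p≤q = subst (ℚ._≤ q - p) (ℚP.+-inverseʳ p) (ℚP.+-monoˡ-≤ (ℚ.- p) p≤q)

  0<+ : ∀ {p q} → 0ℚ < p → 0ℚ < q → 0ℚ < p + q
  0<+ = ℚP.+-mono-<

  0<+≤ : ∀ {p q} → 0ℚ < p → 0ℚ ℚ.≤ q → 0ℚ < p + q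
  0<+≤ = ℚP.+-mono-<-≤

  <-⊓ : ∀ {p q r} → p < q → p < r → p < q ⊓ r
  <-⊓ {p} {q} {r} p<q p<r with ℚP.≤-total q r
  ... | inj₁ q≤r = subst (p <_) (sym (ℚP.p≤q⇒p⊓q≡p q≤r)) p<q
  ... | inj₂ r≤q = subst (p <_) (sym (ℚP.p≥q⇒p⊓q≡q r≤q)) p<r

  <-split : ∀ p q → p < q ⊎ q ℚ.≤ p
  <-split p q with p ℚP.<? q
  ... | yes p<q = inj₁ p<q
  ... | no  p≮q = inj₂ (ℚP.≮⇒≥ p≮q)

  between₂ : ∀ {p q r} → p < q → p < r → ∃[ m ] p < m × m < q × m < r
  between₂ {p} {q} {r} p<q p<r with ℚP.<-dense (<-⊓ p<q p<r)
  ... | m , p<m , m<⊓ = m , p<m , ℚP.<-≤-trans m<⊓ (ℚP.p⊓q≤p q r) , ℚP.<-≤-trans m<⊓ (ℚP.p⊓q≤q q r)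

  fifth : ∀ {p q} → p < q → ∃[ ε ] 0ℚ < ε × q ≡ p + (ε + ε + ε + ε + ε)
  fifth {p} {q} p<q = (q - p) ℚ.* ⅕ , pos
    , solve 2 (λ p q → q := p :+ ((q :- p) :* con ⅕ :+ (q :- p) :* con ⅕ :+ (q :- p) :* con ⅕
        :+ (q :- p) :* con ⅕ :+ (q :- p) :* con ⅕)) refl p q
    where
    ⅕ : ℚ
    ⅕ = + 1 ℚ./ 5
    pos : 0ℚ < (q - p) ℚ.* ⅕
    pos = subst (_< (q - p) ℚ.* ⅕) (ℚP.*-zeroˡ ⅕) (ℚP.*-monoˡ-<-pos ⅕ (0<- p<q))

  times : ℕ → ℚ → ℚ
  times zero    ε = 0ℚ
  times (suc n) ε = times n ε + ε

  private
    times-toℚᵘ : ∀ n k d .(c : Coprime k (suc d)) → ℚ.toℚᵘ (times n (mkℚ (+ k) d c)) ℚᵘ.≃ ℚᵘ.mkℚᵘ (+ (n ℕ.* k)) d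
    times-toℚᵘ zero    k d c = ℚᵘ.*≡* refl
    times-toℚᵘ (suc n) k d c = ℚᵘP.≃-trans (ℚP.toℚᵘ-homo-+ (times n (mkℚ (+ k) d c)) (mkℚ (+ k) d c))
      (ℚᵘP.≃-trans (ℚᵘP.+-congˡ (ℚᵘ.mkℚᵘ (+ k) d) (times-toℚᵘ n k d c)) (ℚᵘ.*≡* eq))
      where
      D = + suc d
      ring : ∀ a b D → (a ℤ.* D ℤ.+ b ℤ.* D) ℤ.* D ≡ (b ℤ.+ a) ℤ.* (D ℤ.* D)
      ring = Z.solve 3 (λ a b D → (a Z.:* D Z.:+ b Z.:* D) Z.:* D Z.:= (b Z.:+ a) Z.:* (D Z.:* D)) refl
      eq : (+ (n ℕ.* k) ℤ.* D ℤ.+ + k ℤ.* D) ℤ.* D ≡ + (k ℕ.+ n ℕ.* k) ℤ.* (D ℤ.* D)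
      eq = ring (+ (n ℕ.* k)) (+ k) D

  archimedean : ∀ {ε} → 0ℚ < ε → ∃[ n ] 1ℚ ℚ.≤ times n ε
  archimedean {mkℚ (+ zero) d c}  0<ε = ⊥-elim (ℚP.<-irrefl (sym (ℚP.↥p≡0⇒p≡0 (mkℚ (+ zero) d c) refl)) 0<ε)
  archimedean {mkℚ -[1+ k ] d c}  0<ε = ⊥-elim (ℚP.<-asym 0<ε (ℚP.negative⁻¹ (mkℚ -[1+ k ] d c)))
  archimedean {mkℚ (+ suc k) d c} 0<ε = suc d , ℚP.toℚᵘ-cancel-≤
    (ℚᵘP.≤-respʳ-≃ (ℚᵘP.≃-sym (times-toℚᵘ (suc d) (suc k) d c))
      (ℚᵘ.*≤* (subst (ℤ._≤ (+ (suc d ℕ.* suc k) ℤ.* + 1)) (sym (ℤP.*-identityˡ (+ suc d)))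
        (subst (+ suc d ℤ.≤_) (sym (ℤP.*-identityʳ _)) (ℤ.+≤+ (ℕP.m≤m*n (suc d) (suc k)))))))

open ℚLemmas

-- An element of the real unit interval is represented by the Dedekind cut of the
-- rationals strictly below it (a lower set without greatest element).
record [0,1] (p : Level) : Set (lsuc p) where
  no-eta-equality
  field
    Below    : Pred ℚ p
    downward : ∀ {q r} → q < r → r ∈ Below → q ∈ Below
    rounded  : ∀ {q} → q ∈ Below → ∃[ r ] q < r × r ∈ Below
    ≥0       : ∀ {q} → q < 0ℚ → q ∈ Below
    ≤1       : ∀ {q} → q ∈ Below → q < 1ℚ

open [0,1] public

module _ {p : Level} where

  infix  8 ~ᴵ_
  infixl 6 _⊕ᴵ_
  infix  4 _≈ᴵ_

  record _≈ᴵ_ (x y : [0,1] p) : Set p where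
    constructor ⟨_,_⟩
    field
      ≈⇒⊆ : Below x ⊆ Below y
      ≈⇒⊇ : Below y ⊆ Below x
  open _≈ᴵ_ public

  constᴵ : ℚ[0,1] → [0,1] p
  Below    (constᴵ r) q = Lift p (q < value r)
  downward (constᴵ r) q<s s<r = lift (ℚP.<-trans q<s (lower s<r))
  rounded  (constᴵ r) q<r = let s , q<s , s<r = ℚP.<-dense (lower q<r) in s , q<s , lift s<r
  ≥0       (constᴵ r) q<0 = lift (ℚP.<-≤-trans q<0 (0≤value r))
  ≤1       (constᴵ r) q<r = ℚP.<-≤-trans (lower q<r) (value≤1 r)

  -- min {x + y , 1}
  _⊕ᴵ_ : [0,1] p → [0,1] p → [0,1] p
  Below    (x ⊕ᴵ y) q = q < 1ℚ × (∃[ a ] ∃[ b ] a ∈ Below x × b ∈ Below y × q < a + b)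
  downward (x ⊕ᴵ y) q<r (r<1 , a , b , a∈ , b∈ , r<) =
    ℚP.<-trans q<r r<1 , a , b , a∈ , b∈ , ℚP.<-trans q<r r<
  rounded  (x ⊕ᴵ y) (q<1 , a , b , a∈ , b∈ , q<) =
    let r , q<r , r<1 , r< = between₂ q<1 q< in r , q<r , r<1 , a , b , a∈ , b∈ , r<
  ≥0       (x ⊕ᴵ y) {q} q<0 = let ε , 0<ε , 0≡ = fifth q<0 in
    ℚP.<-trans q<0 0<1 , ℚ.- ε , ℚ.- ε , ≥0 x (ℚP.neg-antimono-< 0<ε) , ≥0 y (ℚP.neg-antimono-< 0<ε) ,
    <-by (ε + ε + ε) (0<+ (0<+ 0<ε 0<ε) 0<ε) (negative q ε 0≡)
    where
    open +-*-Solver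
    negative : ∀ q ε → 0ℚ ≡ q + (ε + ε + ε + ε + ε) → ℚ.- ε + ℚ.- ε ≡ q + (ε + ε + ε)
    negative q ε 0≡ = trans
      (solve 1 (λ ε → :- ε :+ :- ε := con 0ℚ :+ (:- ε :+ :- ε)) refl ε)
      (trans (cong (_+ (ℚ.- ε + ℚ.- ε)) 0≡)
      (solve 2 (λ q ε → q :+ (ε :+ ε :+ ε :+ ε :+ ε) :+ (:- ε :+ :- ε) := q :+ (ε :+ ε :+ ε)) refl q ε))
  ≤1       (x ⊕ᴵ y) = proj₁

  -- 1 - x, which exceeds q exactly when q < 1 - r for some rational r ≥ x.
  ~ᴵ_ : [0,1] p → [0,1] p
  Below    (~ᴵ x) q = ∃[ r ] r ∉ Below x × q < 1ℚ - r
  downward (~ᴵ x) q<s (r , r∉ , s<) = r , r∉ , ℚP.<-trans q<s s<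
  rounded  (~ᴵ x) (r , r∉ , q<) = let s , q<s , s< = ℚP.<-dense q< in s , q<s , r , r∉ , s<
  ≥0       (~ᴵ x) {q} q<0 = 1ℚ , (λ 1∈ → ℚP.<-irrefl refl (≤1 x 1∈)) , subst (q <_) (sym (ℚP.+-inverseʳ 1ℚ)) q<0
  ≤1       (~ᴵ x) {q} (r , r∉ , q<) = ℚP.<-≤-trans q<
    (≤-by r (ℚP.≮⇒≥ (λ r<0 → r∉ (≥0 x r<0))) (solve 1 (λ r → con 1ℚ := (con 1ℚ :- r) :+ r) refl r))
    where open +-*-Solver

  -- The infimum of a family of reals is the interior of the intersection of the cuts;
  -- the bound r ≤ 1 makes the empty infimum equal to 1.
  ⋀ : {M : Set p} → (M → [0,1] p) → [0,1] p
  Below    (⋀ f) q = ∃[ r ] q < r × r ℚ.≤ 1ℚ × (∀ m → r ∈ Below (f m))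
  downward (⋀ f) q<s (r , s<r , r≤1 , r∈) = r , ℚP.<-trans q<s s<r , r≤1 , r∈
  rounded  (⋀ f) (r , q<r , r≤1 , r∈) = let s , q<s , s<r = ℚP.<-dense q<r in s , q<s , r , s<r , r≤1 , r∈
  ≥0       (⋀ f) q<0 = let r , q<r , r<0 = ℚP.<-dense q<0 in
    r , q<r , ℚP.<⇒≤ (ℚP.<-trans r<0 0<1) , λ m → ≥0 (f m) r<0
  ≤1       (⋀ f) (r , q<r , r≤1 , _) = ℚP.<-≤-trans q<r r≤1

  infix 4 _≤ᴵ_
  _≤ᴵ_ : Rel ([0,1] p) p
  x ≤ᴵ y = Below x ⊆ Below y

  ⋀-lowerBound : ∀ {M : Set p} (f : M → [0,1] p) m → ⋀ f ≤ᴵ f m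
  ⋀-lowerBound f m (r , q<r , _ , r∈) = downward (f m) q<r (r∈ m)

  ⋀-greatest : ∀ {M : Set p} (f : M → [0,1] p) x → (∀ m → x ≤ᴵ f m) → x ≤ᴵ ⋀ f
  ⋀-greatest f x x≤ q∈ = let r , q<r , r∈ = rounded x q∈ in r , q<r , ℚP.<⇒≤ (≤1 x r∈) , λ m → x≤ m r∈

  ≈ᴵ-isEquivalence : IsEquivalence _≈ᴵ_
  ≈ᴵ-isEquivalence = record
    { refl  = ⟨ (λ z → z) , (λ z → z) ⟩
    ; sym   = λ e → ⟨ ≈⇒⊇ e , ≈⇒⊆ e ⟩
    ; trans = λ e f → ⟨ (λ z → ≈⇒⊆ f (≈⇒⊆ e z)) , (λ z → ≈⇒⊇ e (≈⇒⊇ f z)) ⟩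
    }

  ⊕ᴵ-mono : ∀ {x x′ y y′} → x ≤ᴵ x′ → y ≤ᴵ y′ → x ⊕ᴵ y ≤ᴵ x′ ⊕ᴵ y′
  ⊕ᴵ-mono x≤ y≤ (q<1 , a , b , a∈ , b∈ , q<) = q<1 , a , b , x≤ a∈ , y≤ b∈ , q<

  ~ᴵ-antitone : ∀ {x y} → x ≤ᴵ y → ~ᴵ y ≤ᴵ ~ᴵ x
  ~ᴵ-antitone x≤ (r , r∉ , q<) = r , (λ r∈ → r∉ (x≤ r∈)) , q<

  ⊕ᴵ-cong : ∀ {x x′ y y′} → x ≈ᴵ x′ → y ≈ᴵ y′ → x ⊕ᴵ y ≈ᴵ x′ ⊕ᴵ y′
  ⊕ᴵ-cong {x} {x′} {y} {y′} e f =
    ⟨ ⊕ᴵ-mono {x} {x′} {y} {y′} (≈⇒⊆ e) (≈⇒⊆ f) , ⊕ᴵ-mono {x′} {x} {y′} {y} (≈⇒⊇ e) (≈⇒⊇ f) ⟩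

  ~ᴵ-cong : ∀ {x y} → x ≈ᴵ y → ~ᴵ x ≈ᴵ ~ᴵ y
  ~ᴵ-cong {x} {y} e = ⟨ ~ᴵ-antitone {y} {x} (≈⇒⊇ e) , ~ᴵ-antitone {x} {y} (≈⇒⊆ e) ⟩

[0,1]-raw : ∀ p → RawPavelkaAlgebra (lsuc p) p
[0,1]-raw p = record
  { Carrier = [0,1] p ; _≈_ = _≈ᴵ_ ; _⊕_ = _⊕ᴵ_ ; ~_ = ~ᴵ_ ; const = constᴵ }

module _ {p : Level} where
  private module I = RawPavelkaAlgebra ([0,1]-raw p)
  open +-*-Solver

  below-1 : ∀ {q} → q < 1ℚ → q ∈ Below I.1#
  below-1 {q} q<1 = 0ℚ , (λ 0<0 → ℚP.<-irrefl refl (lower 0<0)) , q<1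

  ⇒1⇒≤ᴵ : ∀ u v → u I.⇒ v I.≈ I.1# → u ≤ᴵ v
  ⇒1⇒≤ᴵ u v ⟨ _ , 1≤ ⟩ {q} q∈ with rounded u q∈
  ... | q′ , q<q′ , q′∈ with 1≤ (below-1 (<-by (q′ - q) (0<- q<q′)
          (solve 2 (λ q q′ → con 1ℚ := (con 1ℚ :- (q′ :- q)) :+ (q′ :- q)) refl q q′)))
  ... | _ , a , b , (r , r∉ , a<1-r) , b∈ , t<a+b = downward v (<-by _ (0<+ (0<+≤ (0<- a<1-r) (0≤- q′≤r)) (0<- t<a+b))
          (solve 5 (λ q q′ r a b → b := q :+ (((con 1ℚ :- r) :- a) :+ (r :- q′) :+ (a :+ b :- (con 1ℚ :- (q′ :- q))))) refl q q′ r a b)) b∈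
    where
    q′≤r : q′ ℚ.≤ r
    q′≤r = ℚP.≮⇒≥ λ r<q′ → r∉ (downward u r<q′ q′∈)

  -- Every real is approximated by rationals to within ε.
  approximate : ExcludedMiddle p → (x : [0,1] p) → ∀ {ε} → 0ℚ < ε → ∃[ a ] a ∈ Below x × (a + ε) ∉ Below x
  approximate em x {ε} 0<ε with archimedean 0<ε
  ... | n , 1≤ with search (suc n)
    where
    search : ∀ n → (∃[ a ] a ∈ Below x × (a + ε) ∉ Below x) ⊎ (times n ε - ε) ∈ Below x
    search zero = inj₂ (≥0 x (<-by ε 0<ε (solve 1 (λ ε → con 0ℚ := con 0ℚ :- ε :+ ε) refl ε)))
    search (suc n) with search n
    ... | inj₁ found = inj₁ found
    ... | inj₂ a∈ with em {((times n ε - ε) + ε) ∈ Below x}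
    ... | no  a+ε∉ = inj₁ (_ , a∈ , a+ε∉)
    ... | yes a+ε∈ = inj₂ (subst (_∈ Below x) (solve 2 (λ t ε → t :- ε :+ ε := t :+ ε :- ε) refl (times n ε) ε) a+ε∈)
  ... | inj₁ found = found
  ... | inj₂ 1∈ = ⊥-elim (ℚP.<-irrefl refl (ℚP.<-≤-trans (≤1 x 1∈)
          (subst (1ℚ ℚ.≤_) (solve 2 (λ t ε → t := t :+ ε :- ε) refl (times n ε) ε) 1≤)))

  ⇒-reflᴵ : ExcludedMiddle p → ∀ u v → u I.≈ v → u I.⇒ v I.≈ I.1#
  ⇒-reflᴵ em u v ⟨ u≤ , _ ⟩ = ⟨ (λ q∈ → below-1 (≤1 (u I.⇒ v) q∈)) , (λ {q} q∈ →
    let q<1 = ≤1 I.1# q∈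
        ε , 0<ε , 1≡ = fifth q<1
        a , a∈ , a+ε∉ = approximate em u 0<ε
    in q<1 , 1ℚ - (a + ε) - ε , a , (a + ε , a+ε∉ ,
         <-by ε 0<ε (solve 2 (λ a ε → con 1ℚ :- (a :+ ε) := con 1ℚ :- (a :+ ε) :- ε :+ ε) refl a ε)) , u≤ a∈ ,
         <-by (ε + ε + ε) (0<+ (0<+ 0<ε 0<ε) 0<ε)
           (trans (cong (λ z → z - (a + ε) - ε + a) 1≡)
             (solve 3 (λ q a ε → (q :+ (ε :+ ε :+ ε :+ ε :+ ε)) :- (a :+ ε) :- ε :+ a := q :+ (ε :+ ε :+ ε)) refl q a ε))) ⟩

lower-em : ∀ {a} b → ExcludedMiddle (a ⊔ b) → ExcludedMiddle a
lower-em b em {P} = Dec-map′ lower lift (em {Lift b P})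

module Constants {c ℓ} (B : PavelkaAlgebra c ℓ) where
  open PavelkaAlgebra B
  open MVProperties reduct
  open SetoidReasoning setoid
  open +-*-Solver

  infixl 6 _⊕ᵘ_
  _⊕ᵘ_ : ℚ[0,1] → ℚ[0,1] → ℚ[0,1]
  r ⊕ᵘ s = ⟪ (value r + value s) ⊓ 1ℚ
           , ℚP.⊓-glb (ℚP.+-mono-≤ (0≤value r) (0≤value s)) (ℚP.<⇒≤ 0<1)
           , ℚP.p⊓q≤q (value r + value s) 1ℚ ⟫

  ~ᵘ_ : ℚ[0,1] → ℚ[0,1]
  ~ᵘ r = ⟪ 1ℚ - value r
         , 0≤- (value≤1 r)
         , ≤-by (value r) (0≤value r) (solve 1 (λ r → con 1ℚ := con 1ℚ :- r :+ r) refl (value r)) ⟫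

  const-1 : const 1ᵘ ≈ 1#
  const-1 = ≈-sym (const-~ 0ᵘ 1ᵘ refl)

  const-mono : ∀ r s → value r ℚ.≤ value s → const r ≤ const s
  const-mono r s r≤s = ⊕⇒≤ (const d) (≈-sym (const-⊕ r d s eq))
    where
    d : ℚ[0,1]
    d = ⟪ value s - value r , 0≤- r≤s
        , ℚP.≤-trans (≤-by (value r) (0≤value r)
            (solve 2 (λ r s → s := s :- r :+ r) refl (value r) (value s))) (value≤1 s) ⟫
    eq : (value r + (value s - value r)) ⊓ 1ℚ ≡ value s
    eq = trans (cong (_⊓ 1ℚ) (solve 2 (λ r s → r :+ (s :- r) := s) refl (value r) (value s)))
               (ℚP.p≤q⇒p⊓q≡p (value≤1 s))

  const-reflect : ¬ (0# ≈ 1#) → ∀ r s → const r ≤ const s → value r ℚ.≤ value s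
  const-reflect 0≉1 r s r≤s with <-split (value s) (value r)
  ... | inj₂ r≤s = r≤s
  ... | inj₁ s<r = ⊥-elim (0≉1 (contra (archimedean (0<- s<r))))
    where
    δ : ℚ[0,1]
    δ = ⟪ value r - value s , ℚP.<⇒≤ (0<- s<r)
        , ℚP.≤-trans (≤-by (value s) (0≤value s)
            (solve 2 (λ r s → r := r :- s :+ s) refl (value r) (value s))) (value≤1 r) ⟫
    ~δ≤ : (value (~ᵘ r) + value s) ⊓ 1ℚ ≡ value (~ᵘ δ)
    ~δ≤ = trans (cong (_⊓ 1ℚ) (solve 2 (λ r s → con 1ℚ :- r :+ s := con 1ℚ :- (r :- s)) refl (value r) (value s)))
                (ℚP.p≤q⇒p⊓q≡p (value≤1 (~ᵘ δ)))
    δ≈0 : const δ ≈ 0#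
    δ≈0 = begin
      const δ                  ≈⟨ ~-involutive _ ⟨
      ~ ~ const δ              ≈⟨ ~-cong (const-~ δ (~ᵘ δ) refl) ⟩
      ~ const (~ᵘ δ)           ≈⟨ ~-cong (const-⊕ (~ᵘ r) s (~ᵘ δ) ~δ≤) ⟨
      ~ (const (~ᵘ r) ⊕ const s) ≈⟨ ~-cong (⊕-cong (const-~ r (~ᵘ r) refl) ≈-refl) ⟨
      ~ (~ const r ⊕ const s)  ≈⟨ ~-cong r≤s ⟩
      ~ 1#                     ≈⟨ ~1≈0 ⟩
      0#                       ∎
    multiples : ∀ n → ∃[ u ] const u ≈ 0# × (times n (value δ) ⊓ 1ℚ) ℚ.≤ value u
    multiples zero    = 0ᵘ , ≈-refl , ℚP.p⊓q≤p 0ℚ 1ℚ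
    multiples (suc n) with multiples n
    ... | u , u≈0 , ≤u = u ⊕ᵘ δ
        , ≈-trans (≈-sym (const-⊕ u δ (u ⊕ᵘ δ) refl)) (≈-trans (⊕-cong u≈0 δ≈0) (identityˡ 0#))
        , ℚP.⊓-glb (bound (ℚP.≤-total (times n (value δ)) 1ℚ)) (ℚP.p⊓q≤q (times n (value δ) + value δ) 1ℚ)
      where
      bound : times n (value δ) ℚ.≤ 1ℚ ⊎ 1ℚ ℚ.≤ times n (value δ) →
              (times n (value δ) + value δ) ⊓ 1ℚ ℚ.≤ value u + value δ
      bound (inj₁ t≤1) = ℚP.≤-trans (ℚP.p⊓q≤p (times n (value δ) + value δ) 1ℚ)
        (ℚP.+-monoˡ-≤ (value δ) (subst (ℚ._≤ value u) (ℚP.p≤q⇒p⊓q≡p t≤1) ≤u))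
      bound (inj₂ 1≤t) = ℚP.≤-trans (ℚP.p⊓q≤q (times n (value δ) + value δ) 1ℚ)
        (ℚP.≤-trans (subst (ℚ._≤ value u) (ℚP.p≥q⇒p⊓q≡q 1≤t) ≤u) (≤-by (value δ) (0≤value δ) refl))
    contra : (∃[ n ] 1ℚ ℚ.≤ times n (value δ)) → 0# ≈ 1#
    contra (n , 1≤) with multiples n
    ... | u , u≈0 , ≤u = ≤-antisym (0-≤ 1#) (≤-trans (≤-reflexive (≈-sym const-1))
          (≤-trans (const-mono 1ᵘ u (subst (ℚ._≤ value u) (ℚP.p≥q⇒p⊓q≡q 1≤) ≤u)) (≤-reflexive u≈0)))

module StandardEmbedding {c ℓ} (B : PavelkaAlgebra c ℓ) (em : ExcludedMiddle (lsuc ℓ))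
    (0≉1 : ¬ PavelkaAlgebra._≈_ B (PavelkaAlgebra.0# B) (PavelkaAlgebra.1# B)) (simple : Archimedean (PavelkaAlgebra.reduct B)) where
  open PavelkaAlgebra B
  open MVProperties reduct
  open Constants B
  open +-*-Solver
  private module I = RawPavelkaAlgebra ([0,1]-raw (lsuc ℓ))

  total : ∀ x y → x ≤ y ⊎ y ≤ x
  total x y with simple (x ⇒ y)
  ... | inj₁ x≤y = inj₁ x≤y
  ... | inj₂ (n , ≈0) = inj₂ (≤-antisym (≤-1 _) (≤-trans
          (≤-reflexive (≈-sym (≈-trans (⊕-cong (~-cong ≈0) ≈-refl) (⊕-zeroˡ _)))) (prelinear-^ x y n)))

  standardPart : Carrier → [0,1] (lsuc ℓ)
  Below    (standardPart x) q = Lift (lsuc ℓ) (q < 0ℚ ⊎ (∃[ r ] q < value r × const r ≤ x))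
  downward (standardPart x) q<s (lift (inj₁ s<0)) = lift (inj₁ (ℚP.<-trans q<s s<0))
  downward (standardPart x) q<s (lift (inj₂ (r , s<r , r≤x))) = lift (inj₂ (r , ℚP.<-trans q<s s<r , r≤x))
  rounded  (standardPart x) (lift (inj₁ q<0)) =
    let s , q<s , s<0 = ℚP.<-dense q<0 in s , q<s , lift (inj₁ s<0)
  rounded  (standardPart x) (lift (inj₂ (r , q<r , r≤x))) =
    let s , q<s , s<r = ℚP.<-dense q<r in s , q<s , lift (inj₂ (r , s<r , r≤x))
  ≥0       (standardPart x) q<0 = lift (inj₁ q<0)
  ≤1       (standardPart x) (lift (inj₁ q<0)) = ℚP.<-trans q<0 0<1
  ≤1       (standardPart x) (lift (inj₂ (r , q<r , _))) = ℚP.<-≤-trans q<r (value≤1 r)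

  mono : ∀ {x y} → x ≤ y → standardPart x ≤ᴵ standardPart y
  mono x≤y (lift (inj₁ q<0)) = lift (inj₁ q<0)
  mono x≤y (lift (inj₂ (r , q<r , r≤x))) = lift (inj₂ (r , q<r , ≤-trans r≤x x≤y))

  private
    ∉⇒≥0 : ∀ {x q} → q ∉ Below (standardPart x) → 0ℚ ℚ.≤ q
    ∉⇒≥0 q∉ = ℚP.≮⇒≥ λ q<0 → q∉ (lift (inj₁ q<0))

    ∉⇒≤const : ∀ {x q t} → q ∉ Below (standardPart x) → q < t → ∃[ s ] value s ℚ.≤ t × x ≤ const s
    ∉⇒≤const {x} {q} {t} q∉ q<t with ℚP.≤-total t 1ℚ
    ... | inj₂ 1≤t = 1ᵘ , 1≤t , ≤-trans (≤-1 x) (≤-reflexive (≈-sym const-1))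
    ... | inj₁ t≤1 with total x (const ⟪ t , ℚP.≤-trans (∉⇒≥0 q∉) (ℚP.<⇒≤ q<t) , t≤1 ⟫)
    ... | inj₁ x≤t = _ , ℚP.≤-refl , x≤t
    ... | inj₂ t≤x = ⊥-elim (q∉ (lift (inj₂ (_ , q<t , t≤x))))

  const-homo : ∀ r → standardPart (const r) I.≈ I.const r
  const-homo r = ⟨ to , from ⟩
    where
    to : standardPart (const r) ≤ᴵ I.const r
    to (lift (inj₁ q<0)) = lift (ℚP.<-≤-trans q<0 (0≤value r))
    to (lift (inj₂ (s , q<s , s≤r))) = lift (ℚP.<-≤-trans q<s (const-reflect 0≉1 s r s≤r))
    from : I.const r ≤ᴵ standardPart (const r)
    from (lift q<r) = lift (inj₂ (r , q<r , ≤-refl))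

  ~-homo : ∀ x → standardPart (~ x) I.≈ I.~ standardPart x
  ~-homo x = ⟨ to , from ⟩
    where
    to : standardPart (~ x) ≤ᴵ I.~ standardPart x
    to (lift (inj₁ q<0)) = ≥0 (I.~ standardPart x) q<0
    to {q} (lift (inj₂ (s , q<s , s≤~x))) = 1ℚ - value s , ∉
        , subst (q <_) (solve 1 (λ s → s := con 1ℚ :- (con 1ℚ :- s)) refl (value s)) q<s
      where
      ∉ : (1ℚ - value s) ∉ Below (standardPart x)
      ∉ (lift (inj₁ <0)) = ℚP.<-irrefl refl (ℚP.≤-<-trans (0≤value (~ᵘ s)) <0)
      ∉ (lift (inj₂ (t , <t , t≤x))) = ℚP.<-irrefl refl (ℚP.<-≤-trans <t (const-reflect 0≉1 t (~ᵘ s)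
        (≤-trans t≤x (≤-trans (≤-reflexive (≈-sym (~-involutive x)))
          (≤-trans (~-antitone s≤~x) (≤-reflexive (const-~ s (~ᵘ s) refl)))))))
    from : I.~ standardPart x ≤ᴵ standardPart (~ x)
    from {q} (r , r∉ , q<1-r) = step (ℚP.<-dense q<1-r)
      where
      collect₁ : ∀ r m → 1ℚ - m ≡ r + (1ℚ - r - m)
      collect₁ = solve 2 (λ r m → con 1ℚ :- m := r :+ (con 1ℚ :- r :- m)) refl
      collect₂ : ∀ m s → 1ℚ - s ≡ m + (1ℚ - m - s)
      collect₂ = solve 2 (λ m s → con 1ℚ :- s := m :+ (con 1ℚ :- m :- s)) refl
      finish : ∀ {m} → q < m → (∃[ s ] value s ℚ.≤ 1ℚ - m × x ≤ const s) → q ∈ Below (standardPart (~ x))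
      finish {m} q<m (s , s≤1-m , x≤s) = lift (inj₂ (~ᵘ s
        , ℚP.<-≤-trans q<m (≤-by (1ℚ - m - value s) (0≤- s≤1-m) (collect₂ m (value s)))
        , ≤-trans (≤-reflexive (≈-sym (const-~ s (~ᵘ s) refl))) (~-antitone x≤s)))
      step : (∃[ m ] q < m × m < 1ℚ - r) → q ∈ Below (standardPart (~ x))
      step (m , q<m , m<1-r) = finish q<m (∉⇒≤const r∉ (<-by (1ℚ - r - m) (0<- m<1-r) (collect₁ r m)))

  ⊕-homo : ∀ x y → standardPart (x ⊕ y) I.≈ standardPart x I.⊕ standardPart y
  ⊕-homo x y = ⟨ to , from ⟩
    where
    to : standardPart (x ⊕ y) ≤ᴵ standardPart x I.⊕ standardPart y
    to (lift (inj₁ q<0)) = ≥0 (standardPart x I.⊕ standardPart y) q<0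
    to {q} (lift (inj₂ (r , q<r , r≤x⊕y))) = step (fifth q<r)
      where
      collect : ∀ q a b ε → a + b ≡ q + (ε + ((a + ε + ε) + (b + ε + ε) - (q + (ε + ε + ε + ε + ε))))
      collect = solve 4 (λ q a b ε → a :+ b := q :+ (ε :+ ((a :+ ε :+ ε) :+ (b :+ ε :+ ε)
                  :- (q :+ (ε :+ ε :+ ε :+ ε :+ ε))))) refl
      finish : ∀ {ε a b} → 0ℚ < ε → value r ≡ q + (ε + ε + ε + ε + ε) →
               a ∈ Below (standardPart x) → b ∈ Below (standardPart y) →
               (∃[ s ] value s ℚ.≤ a + ε + ε × x ≤ const s) → (∃[ t ] value t ℚ.≤ b + ε + ε × y ≤ const t) →
               q ∈ Below (standardPart x I.⊕ standardPart y)
      finish {ε} {a} {b} 0<ε r≡ a∈ b∈ (s , s≤ , x≤s) (t , t≤ , y≤t) =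
        ℚP.<-≤-trans q<r (value≤1 r) , a , b , a∈ , b∈ ,
        <-by (ε + ((a + ε + ε) + (b + ε + ε) - value r)) (0<+≤ 0<ε (0≤- r≤))
          (trans (collect q a b ε) (cong (λ z → q + (ε + ((a + ε + ε) + (b + ε + ε) - z))) (sym r≡)))
        where
        r≤ : value r ℚ.≤ (a + ε + ε) + (b + ε + ε)
        r≤ = ℚP.≤-trans (const-reflect 0≉1 r (s ⊕ᵘ t) (≤-trans r≤x⊕y
               (≤-trans (⊕-mono x≤s y≤t) (≤-reflexive (const-⊕ s t (s ⊕ᵘ t) refl)))))
             (ℚP.≤-trans (ℚP.p⊓q≤p (value s + value t) 1ℚ) (ℚP.+-mono-≤ s≤ t≤))
      approximated : ∀ {ε} → 0ℚ < ε → value r ≡ q + (ε + ε + ε + ε + ε) →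
               (∃[ a ] a ∈ Below (standardPart x) × (a + ε) ∉ Below (standardPart x)) →
               (∃[ b ] b ∈ Below (standardPart y) × (b + ε) ∉ Below (standardPart y)) →
               q ∈ Below (standardPart x I.⊕ standardPart y)
      approximated {ε} 0<ε r≡ (a , a∈ , a+ε∉) (b , b∈ , b+ε∉) = finish 0<ε r≡ a∈ b∈
        (∉⇒≤const a+ε∉ (<-by ε 0<ε refl)) (∉⇒≤const b+ε∉ (<-by ε 0<ε refl))
      step : (∃[ ε ] 0ℚ < ε × value r ≡ q + (ε + ε + ε + ε + ε)) → q ∈ Below (standardPart x I.⊕ standardPart y)
      step (ε , 0<ε , r≡) = approximated 0<ε r≡ (approximate em (standardPart x) 0<ε) (approximate em (standardPart y) 0<ε)
    from : standardPart x I.⊕ standardPart y ≤ᴵ standardPart (x ⊕ y)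
    from {q} (q<1 , a , b , lift (inj₁ a<0) , b∈ , q<a+b) = mono (y≤x⊕y x y) (downward (standardPart y)
      (<-by _ (0<+ (0<- q<a+b) (0<- a<0)) (solve 3 (λ q a b → b := q :+ (a :+ b :- q :+ (con 0ℚ :- a))) refl q a b)) b∈)
    from {q} (q<1 , a , b , lift (inj₂ a∈) , lift (inj₁ b<0) , q<a+b) = mono (x≤x⊕y x y) (downward (standardPart x)
      (<-by _ (0<+ (0<- q<a+b) (0<- b<0)) (solve 3 (λ q a b → a := q :+ (a :+ b :- q :+ (con 0ℚ :- b))) refl q a b))
      (lift (inj₂ a∈)))
    from (q<1 , a , b , lift (inj₂ (r , a<r , r≤x)) , lift (inj₂ (s , b<s , s≤y)) , q<a+b) = lift (inj₂ (r ⊕ᵘ s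
      , <-⊓ (ℚP.<-trans q<a+b (ℚP.+-mono-< a<r b<s)) q<1
      , ≤-trans (≤-reflexive (≈-sym (const-⊕ r s (r ⊕ᵘ s) refl))) (⊕-mono r≤x s≤y)))

  isMVHomomorphism : IsMVHomomorphism mvRaw I.mvRaw standardPart
  isMVHomomorphism = record
    { ⟦⟧-cong = λ x≈y → ⟨ mono (≤-reflexive x≈y) , mono (≤-reflexive (≈-sym x≈y)) ⟩
    ; ⊕-homo  = ⊕-homo
    ; ~-homo  = ~-homo
    ; 0#-homo = const-homo 0ᵘ
    }

  module _ {e : Carrier → [0,1] (lsuc ℓ)} (hom : IsMVHomomorphism mvRaw I.mvRaw e) where
    private
      module H = IsMVHomomorphism hom
      module E = IsEquivalence (≈ᴵ-isEquivalence {lsuc ℓ})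

    1-homo : e 1# I.≈ I.1#
    1-homo = E.trans (H.~-homo 0#) (~ᴵ-cong H.0#-homo)

    ⇒-homo : ∀ x y → e (x ⇒ y) I.≈ e x I.⇒ e y
    ⇒-homo x y = E.trans (H.⊕-homo (~ x) y) (⊕ᴵ-cong (H.~-homo x) E.refl)

    ·-homo : ∀ x y → e (x · y) I.≈ e x I.· e y
    ·-homo x y = E.trans (H.~-homo (~ x ⊕ ~ y))
      (~ᴵ-cong (E.trans (H.⊕-homo (~ x) (~ y)) (⊕ᴵ-cong (H.~-homo x) (H.~-homo y))))

    ·ᴵ-cong : ∀ {u u′ v v′} → u I.≈ u′ → v I.≈ v′ → u I.· v I.≈ u′ I.· v′
    ·ᴵ-cong p q = ~ᴵ-cong (⊕ᴵ-cong (~ᴵ-cong p) (~ᴵ-cong q))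

    hom-mono : ∀ {x y} → x ≤ y → e x ≤ᴵ e y
    hom-mono {x} {y} x≤y = ⇒1⇒≤ᴵ (e x) (e y) (E.trans (E.sym (⇒-homo x y)) (E.trans (H.⟦⟧-cong x≤y) 1-homo))

    ^-homo : ∀ x n → e x I.≈ I.1# → e (x ^ n) I.≈ I.1#
    ^-homo x zero    ex≈1 = 1-homo
    ^-homo x (suc n) ex≈1 = E.trans (·-homo x (x ^ n))
      (E.trans (·ᴵ-cong (E.trans ex≈1 (E.sym 1-homo)) (E.trans (^-homo x n ex≈1) (E.sym 1-homo)))
      (E.trans (E.sym (·-homo 1# 1#)) (E.trans (H.⟦⟧-cong (·-identityˡ 1#)) 1-homo)))

    reflects-≤ : ∀ {x y} → e x I.≈ e y → x ≤ y
    reflects-≤ {x} {y} ex≈ey with simple (x ⇒ y)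
    ... | inj₁ x≤y = x≤y
    ... | inj₂ (n , ≈0) = ⊥-elim (ℚP.<-irrefl refl (lower (≈⇒⊆ 1≈0 0∈)))
      where
      1≈0 : I.1# I.≈ I.0#
      1≈0 = E.trans (E.sym (^-homo (x ⇒ y) n (E.trans (⇒-homo x y) (⇒-reflᴵ em (e x) (e y) ex≈ey))))
              (E.trans (H.⟦⟧-cong ≈0) H.0#-homo)
      0∈ : 0ℚ ∈ Below I.1#
      0∈ = below-1 0<1

    hom-injective : Injective _≈_ I._≈_ e
    hom-injective p = ≤-antisym (reflects-≤ p) (reflects-≤ (E.sym p))

  isEmbedding : IsPavelkaEmbedding raw ([0,1]-raw (lsuc ℓ)) standardPart
  isEmbedding = record
    { isMVHomomorphism = isMVHomomorphism
    ; const-homo       = const-homo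
    ; injective        = hom-injective isMVHomomorphism
    }

  unique : ∀ e → IsPavelkaEmbedding raw ([0,1]-raw (lsuc ℓ)) e → ∀ x → standardPart x I.≈ e x
  unique e emb x = ⟨ to , from ⟩
    where
    open IsPavelkaEmbedding emb renaming (const-homo to e-const; isMVHomomorphism to hom)
    to : standardPart x ≤ᴵ e x
    to (lift (inj₁ q<0)) = ≥0 (e x) q<0
    to (lift (inj₂ (r , q<r , r≤x))) = hom-mono hom r≤x (≈⇒⊇ (e-const r) (lift q<r))
    from : e x ≤ᴵ standardPart x
    from {q} q∈ with <-split q 0ℚ
    ... | inj₁ q<0 = lift (inj₁ q<0)
    ... | inj₂ 0≤q with rounded (e x) q∈
    ... | r , q<r , r∈ with total (const r′) x
      where
      r′ : ℚ[0,1]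
      r′ = ⟪ r , ℚP.≤-trans 0≤q (ℚP.<⇒≤ q<r) , ℚP.<⇒≤ (≤1 (e x) r∈) ⟫
    ... | inj₁ r≤x = lift (inj₂ (_ , q<r , r≤x))
    ... | inj₂ x≤r = ⊥-elim (ℚP.<-irrefl refl (lower (≈⇒⊆ (e-const _) (hom-mono hom x≤r r∈))))

module _ {c ℓ} (em : ExcludedMiddle (lsuc (c ⊔ ℓ))) (A : PavelkaAlgebra c ℓ) where
  open PavelkaAlgebra A using (Carrier)

  -- Excluded middle is the classical metatheory: without it a maximal filter need not
  -- decide its elements, and the cuts of A/F need not respect ⊕ and ~.
  embedsUniquely : ∀ F → Σ[ e ∈ (Carrier → [0,1] (lsuc (c ⊔ ℓ))) ]
    IsPavelkaEmbedding (Quotient.quotientRaw A F) ([0,1]-raw _) e ×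
    (∀ e′ → IsPavelkaEmbedding (Quotient.quotientRaw A F) ([0,1]-raw _) e′ → ∀ x → e x ≈ᴵ e′ x)
  embedsUniquely F = standardPart , isEmbedding , unique
    where
    open Quotient A F
    open StandardEmbedding quotient em quotient-nontrivial
      (quotient-archimedean (lower-em (lsuc (c ⊔ ℓ)) em))

  infix 7 _/_
  _/_ : Carrier → SpecM A → [0,1] (lsuc (c ⊔ ℓ))
  x / F = proj₁ (embedsUniquely F) x

  naturalEmbedding : Carrier → (SpecM A → [0,1] (lsuc (c ⊔ ℓ)))
  naturalEmbedding x F = x / F

module FuzzyContext {p} {M G : Set p} (I : M → G → [0,1] p) where
  open RawPavelkaAlgebra ([0,1]-raw p) using (_⇒_)

  d : (M → [0,1] p) → (G → [0,1] p)
  d x g = ⋀ λ m → x m ⇒ I m g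

  h : (G → [0,1] p) → (M → [0,1] p)
  h y m = ⋀ λ g → y g ⇒ I m g

-- A residuation inequality u ≤ r ⇒ v with a constant r says that the cut of u, moved
-- down by 1 - r, is contained in the cut of v.  In a semisimple A, x ≤ y can be
-- tested on the values x/F, because the kernels of the simple quotients are maximal filters.
-- (i) ⇒ (ii): the context has the values O y / F as incidence degrees.  If the constant r
-- lies below d(n x)(y), then r ≤ x ⇒ O y by semisimplicity, hence r · O x ≤ O (r · x) ≤ O y;
-- letting r increase to d(n x)(y) bounds n (O x) by h (d (n x)).  The index y = x gives the
-- other inequality.
-- (ii) ⇒ (i): n (r · x) lies above n x moved down by 1 - r, and since d and h are antitone,
-- h (d (n (r · x))) then lies above h (d (n x)) moved down by 1 - r.
module Submission where

open import Defs
open import Axiom.ExcludedMiddle using (ExcludedMiddle)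
open import Data.Empty using (⊥-elim)
open import Data.Product using (Σ-syntax; ∃-syntax; _×_; _,_)
open import Data.Rational as ℚ using (ℚ; 0ℚ; 1ℚ; _<_; _+_; _-_)
import Data.Rational.Properties as ℚP
open import Data.Rational.Solver using (module +-*-Solver)
open import Data.Sum using (inj₁; inj₂)
open import Function using (_∘_)
open import Function.Bundles using (_⇔_; mk⇔)
open import Level using (Level; Lift; lift; lower; _⊔_; suc)
open import Relation.Binary using (Rel; module IsEquivalence)
open import Relation.Binary.PropositionalEquality using (refl; trans; cong; subst)
open import Relation.Unary using (Pred; _∈_; _∉_; _⊆_)
open ℚLemmas
open +-*-Solver

-- Kernels of MV-homomorphisms.

module Kernel {c ℓ ℓ′} (A : MVAlgebra c ℓ) (B : MVAlgebra c ℓ′)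
  {f : MVAlgebra.Carrier A → MVAlgebra.Carrier B}
  (hom : IsMVHomomorphism (MVAlgebra.raw A) (MVAlgebra.raw B) f) where
  private
    module A where
      open MVAlgebra A public
      open MVProperties A public
    module B where
      open MVAlgebra B public
      open MVProperties B public
  open IsMVHomomorphism hom

  kernel : Pred A.Carrier ℓ′
  kernel x = f x B.≈ B.1#

  1#-homo : f A.1# B.≈ B.1#
  1#-homo = B.≈-trans (~-homo _) (B.~-cong 0#-homo)

  ⇒-homo : ∀ x y → f (x A.⇒ y) B.≈ f x B.⇒ f y
  ⇒-homo x y = B.≈-trans (⊕-homo _ _) (B.⊕-cong (~-homo x) B.≈-refl)

  ·-homo : ∀ x y → f (x A.· y) B.≈ f x B.· f y
  ·-homo x y = B.≈-trans (~-homo _)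
    (B.~-cong (B.≈-trans (⊕-homo _ _) (B.⊕-cong (~-homo x) (~-homo y))))

  mono : ∀ {x y} → x A.≤ y → f x B.≤ f y
  mono x≤y = B.≈-trans (B.≈-sym (⇒-homo _ _)) (B.≈-trans (⟦⟧-cong x≤y) 1#-homo)

  kernel-isFilter : IsFilter A kernel
  kernel-isFilter = record
    { 1∈       = 1#-homo
    ; ·-closed = λ p q → B.≈-trans (·-homo _ _) (B.≈-trans (B.·-cong p q) (B.·-identityʳ _))
    ; up       = λ x≤y p → B.≤-antisym (B.≤-1 _) (B.≤-trans (B.≤-reflexive (B.≈-sym p)) (mono x≤y))
    }

  ⇒∈kernel : ∀ {x y} → f x B.≈ f y → (x A.⇒ y) ∈ kernel
  ⇒∈kernel p = B.≈-trans (⇒-homo _ _) (B.≤-reflexive p)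

-- The congruence of a filter, for filters not assumed maximal.

module _ {c ℓ p} (A : MVAlgebra c ℓ) {G : Pred (MVAlgebra.Carrier A) p} (isFilter : IsFilter A G) where
  open MVAlgebra A
  open MVProperties A
  open IsFilter isFilter

  infix 4 _∼_
  _∼_ : Rel Carrier p
  x ∼ y = (x ⇒ y) ∈ G × (y ⇒ x) ∈ G

  ∼-sym : ∀ {x y} → x ∼ y → y ∼ x
  ∼-sym (p , q) = q , p

  ∼-trans : ∀ {x y z} → x ∼ y → y ∼ z → x ∼ z
  ∼-trans (p , p′) (q , q′) = up (⇒-trans _ _ _) (·-closed p q) , up (⇒-trans _ _ _) (·-closed q′ p′)

  ≈⇒∼ : ∀ {x y} → x ≈ y → x ∼ y
  ≈⇒∼ p = up (≤-reflexive (≈-sym (≤-reflexive p))) 1∈ , up (≤-reflexive (≈-sym (≤-reflexive (≈-sym p)))) 1∈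

  ∼-⊕ˡ : ∀ {x y} z → x ∼ y → x ⊕ z ∼ y ⊕ z
  ∼-⊕ˡ z (p , q) = up (⇒-⊕ _ _ z) p , up (⇒-⊕ _ _ z) q

  ∼-⊕ : ∀ {x x′ y y′} → x ∼ x′ → y ∼ y′ → x ⊕ y ∼ x′ ⊕ y′
  ∼-⊕ {x} {x′} {y} {y′} p q = ∼-trans (∼-⊕ˡ y p)
    (∼-trans (≈⇒∼ (comm _ _)) (∼-trans (∼-⊕ˡ x′ q) (≈⇒∼ (comm _ _))))

  ∼-~ : ∀ {x y} → x ∼ y → ~ x ∼ ~ y
  ∼-~ (p , q) = up (≤-reflexive (contrapositive _ _)) q , up (≤-reflexive (contrapositive _ _)) p

  ∼1⇒∈ : ∀ {x} → x ∼ 1# → x ∈ G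
  ∼1⇒∈ (_ , p) = up (≤-reflexive (1⇒ _)) p

  ∈⇒∼1 : ∀ {x} → x ∈ G → x ∼ 1#
  ∈⇒∼1 p = up (≤-reflexive (≈-sym (≤-1 _))) 1∈ , up (≤-reflexive (≈-sym (1⇒ _))) p

-- Maximality of the kernel of a surjection onto a simple algebra.

module _ {c ℓ} (A : MVAlgebra c ℓ) (B : MVAlgebra c (c ⊔ ℓ)) (simple : IsSimple B)
  {f : MVAlgebra.Carrier A → MVAlgebra.Carrier B}
  (hom : IsMVHomomorphism (MVAlgebra.raw A) (MVAlgebra.raw B) f)
  (onto : ∀ b → ∃[ a ] MVAlgebra._≈_ B (f a) b) where
  private
    module A where
      open MVAlgebra A public
      open MVProperties A public
    module B where
      open MVAlgebra B public
      open MVProperties B public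
  open Kernel A B hom
  open IsMVHomomorphism hom
  open IsSimple simple

  kernel-proper : Proper kernel
  kernel-proper all with nontrivial
  ... | x , y , x≉y with onto x | onto y
  ... | a , fa≈x | b , fb≈y = x≉y (B.≈-trans (B.≈-sym fa≈x)
          (B.≈-trans (all a) (B.≈-trans (B.≈-sym (all b)) fb≈y)))

  -- Both implications map to 1, so they lie in the kernel. This lets representatives be exchanged
  -- within a fibre.
  fibre-∼ : ∀ {p} {G : Pred A.Carrier p} (isFilter : IsFilter A G) → kernel ⊆ G →
          ∀ {a a′ b} → f a B.≈ b → f a′ B.≈ b → _∼_ A isFilter a a′
  fibre-∼ isFilter kernel⊆G p q =
    kernel⊆G (⇒∈kernel (B.≈-trans p (B.≈-sym q))) , kernel⊆G (⇒∈kernel (B.≈-trans q (B.≈-sym p)))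

  -- Push the congruence of `G` forward to `θ` on `B`. If `θ` is equality, members of `G`, being
  -- congruent to 1, map to 1; if `θ` is full, then 0 is congruent to 1 and `G` is improper.
  kernel-maximal : ∀ (G : Pred A.Carrier (c ⊔ ℓ)) → IsFilter A G → Proper G → kernel ⊆ G → G ⊆ kernel
  kernel-maximal G isFilter proper kernel⊆G {x} x∈G with congruences θ θ-isCongruence
    where
    θ : Rel B.Carrier (c ⊔ ℓ)
    θ b b′ = ∃[ a ] ∃[ a′ ] f a B.≈ b × f a′ B.≈ b′ × _∼_ A isFilter a a′
    θ-reflexive : ∀ {b b′} → b B.≈ b′ → θ b b′
    θ-reflexive {b} b≈b′ with onto b
    ... | a , p = a , a , p , B.≈-trans p b≈b′ , ≈⇒∼ A isFilter A.≈-refl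
    θ-isCongruence : IsMVCongruence B θ
    θ-isCongruence = record
      { isEquivalence = record
        { refl  = θ-reflexive B.≈-refl
        ; sym   = λ (a , a′ , p , p′ , e) → a′ , a , p′ , p , ∼-sym A isFilter e
        ; trans = λ (a , a′ , p , p′ , e) (a₁ , a₂ , p₁ , p₂ , e′) →
            a , a₂ , p , p₂ , ∼-trans A isFilter e (∼-trans A isFilter (fibre-∼ isFilter kernel⊆G p′ p₁) e′)
        }
      ; reflexive     = θ-reflexive
      ; ⊕-compatible  = λ (a , a′ , p , p′ , e) (a₁ , a₂ , p₁ , p₂ , e′) →
          a A.⊕ a₁ , a′ A.⊕ a₂ , B.≈-trans (⊕-homo _ _) (B.⊕-cong p p₁)
          , B.≈-trans (⊕-homo _ _) (B.⊕-cong p′ p₂) , ∼-⊕ A isFilter e e′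
      ; ~-compatible  = λ (a , a′ , p , p′ , e) →
          A.~ a , A.~ a′ , B.≈-trans (~-homo _) (B.~-cong p)
          , B.≈-trans (~-homo _) (B.~-cong p′) , ∼-~ A isFilter e
      }
  ... | inj₁ discrete = discrete _ _ (x , A.1# , B.≈-refl , 1#-homo , ∈⇒∼1 A isFilter x∈G)
  ... | inj₂ total with total B.0# B.1#
  ... | a , a′ , p , p′ , a∼a′ = ⊥-elim (proper λ y → IsFilter.up isFilter (A.0-≤ y)
          (∼1⇒∈ A isFilter (∼-trans A isFilter (fibre-∼ isFilter kernel⊆G 0#-homo p)
            (∼-trans A isFilter a∼a′ (fibre-∼ isFilter kernel⊆G p′ 1#-homo)))))

  kernel-maximalFilter : MaximalFilter A
  kernel-maximalFilter = record
    { filter = kernel ; isFilter = kernel-isFilter ; proper = kernel-proper ; maximal = kernel-maximal }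

-- Cuts moved down by a rational.

module _ {p : Level} where
  private module I = RawPavelkaAlgebra ([0,1]-raw p)

  infix 4 _≤[_]_
  _≤[_]_ : [0,1] p → ℚ → [0,1] p → Set p
  u ≤[ δ ] v = ∀ {q} → q ∈ Below u → q - δ ∈ Below v

  ⋀-shift : ∀ {M : Set p} (f g : M → [0,1] p) {δ} → 0ℚ ℚ.≤ δ → (∀ m → f m ≤[ δ ] g m) → ⋀ f ≤[ δ ] ⋀ g
  ⋀-shift f g {δ} 0≤δ f≤g (r , q<r , r≤1 , r∈) = r - δ , ℚP.+-monoˡ-< (ℚ.- δ) q<r ,
    ℚP.≤-trans (≤-by δ 0≤δ (solve 2 (λ r δ → r := r :- δ :+ δ) refl r δ)) r≤1 , λ m → f≤g m (r∈ m)

  -- If `r` is outside the cut of `u′`, then `r + δ` is outside that of `u`, so the summand below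
  -- the negation drops by δ.
  ⇒-shiftˡ : ∀ {u u′ v δ} → 0ℚ ℚ.≤ δ → u ≤[ δ ] u′ → u′ I.⇒ v ≤[ δ ] u I.⇒ v
  ⇒-shiftˡ {u} {u′} {v} {δ} 0≤δ u≤u′ {q} (q<1 , a , b , (r , r∉ , a<1-r) , b∈ , q<a+b) =
    ℚP.≤-<-trans (≤-by δ 0≤δ (solve 2 (λ q δ → q := q :- δ :+ δ) refl q δ)) q<1 ,
    a - δ , b ,
    (r + δ , (λ r+δ∈ → r∉ (subst (_∈ Below u′) (solve 2 (λ r δ → r :+ δ :- δ := r) refl r δ) (u≤u′ r+δ∈))) ,
      <-by (1ℚ - r - a) (0<- a<1-r)
        (solve 3 (λ r δ a → con 1ℚ :- (r :+ δ) := a :- δ :+ (con 1ℚ :- r :- a)) refl r δ a)) ,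
    b∈ ,
    <-by (a + b - q) (0<- q<a+b) (solve 4 (λ q a b δ → a :- δ :+ b := q :- δ :+ (a :+ b :- q)) refl q a b δ)

  -- Rounding `q` up to `q′ = q + 5ε` pays for the summand `1 - r - ε`, which must be strictly below
  -- `1 - r`.
  ⇒-intro : ∀ {u v} r → u ≤[ 1ℚ - value r ] v → u ≤ᴵ constᴵ r I.⇒ v
  ⇒-intro {u} {v} r u≤v {q} q∈ =
    let q′ , q<q′ , q′∈ = rounded u q∈
        ε , 0<ε , q′≡ = fifth q<q′
    in ≤1 u q∈ , 1ℚ - value r - ε , q′ - (1ℚ - value r) ,
      (value r , (λ r<r → ℚP.<-irrefl refl (lower r<r)) ,
        <-by ε 0<ε (solve 2 (λ r ε → con 1ℚ :- r := con 1ℚ :- r :- ε :+ ε) refl (value r) ε)) ,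
      u≤v q′∈ ,
      <-by (ε + ε + ε + ε) (0<+ (0<+ (0<+ 0<ε 0<ε) 0<ε) 0<ε)
        (trans (cong (λ z → 1ℚ - value r - ε + (z - (1ℚ - value r))) q′≡)
          (solve 3 (λ q r ε → con 1ℚ :- r :- ε :+ (q :+ (ε :+ ε :+ ε :+ ε :+ ε) :- (con 1ℚ :- r))
            := q :+ (ε :+ ε :+ ε :+ ε)) refl q (value r) ε))

  -- Since a < 1 - s ≤ 1 - r and q < a + b, the summand `b` exceeds q - (1 - r).
  ⇒-elim : ∀ {u v} r → u ≤ᴵ constᴵ r I.⇒ v → u ≤[ 1ℚ - value r ] v
  ⇒-elim {u} {v} r u≤ {q} q∈ with u≤ q∈
  ... | _ , a , b , (s , s∉ , a<1-s) , b∈ , q<a+b = downward v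
    (<-by _ (0<+≤ (0<+ (0<- a<1-s) (0<- q<a+b)) (0≤- r≤s))
      (solve 5 (λ q a b r s → b := q :- (con 1ℚ :- r) :+ (con 1ℚ :- s :- a :+ (a :+ b :- q) :+ (s :- r)))
        refl q a b (value r) s)) b∈
    where
    r≤s : value r ℚ.≤ s
    r≤s = ℚP.≮⇒≥ λ s<r → s∉ (lift s<r)

  1≤⇒⇒-elim : ∀ {u v} → I.1# ≤ᴵ u → u I.⇒ v ≤ᴵ v
  1≤⇒⇒-elim {u} {v} 1≤u {q} (_ , a , b , (s , s∉ , a<1-s) , b∈ , q<a+b) = downward v
    (<-by _ (0<+≤ (0<+ (0<- a<1-s) (0<- q<a+b)) (0≤- 1≤s))
      (solve 4 (λ q a b s → b := q :+ (con 1ℚ :- s :- a :+ (a :+ b :- q) :+ (s :- con 1ℚ))) refl q a b s)) b∈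
    where
    1≤s : 1ℚ ℚ.≤ s
    1≤s = ℚP.≮⇒≥ λ s<1 → s∉ (1≤u (below-1 s<1))

  approximateᵘ : ExcludedMiddle p → (x : [0,1] p) → ∀ {ε} → 0ℚ < ε →
                 ∃[ r ] constᴵ r ≤ᴵ x × (value r + ε) ∉ Below x
  approximateᵘ em x {ε} 0<ε with approximate em x 0<ε
  ... | a , a∈ , a+ε∉ with <-split a 0ℚ
  -- A negative approximation is replaced by 0; as `a + ε` is already outside the cut, so is ε.
  ... | inj₁ a<0 = 0ᵘ , ≥0 x ∘ lower , λ ε∈ → a+ε∉ (downward x (ℚP.+-monoˡ-< ε a<0) ε∈)
  ... | inj₂ 0≤a = ⟪ a , 0≤a , ℚP.<⇒≤ (≤1 x a∈) ⟫ , (λ q<a → downward x (lower q<a) a∈) , a+ε∉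

  -- Take `r` below `w` with `r + ε` outside its cut. Of the slack 5ε, one ε pays for the
  -- approximation and one for strictness.
  ⇒-limit : ExcludedMiddle p → ∀ {u v} w → (∀ r → constᴵ r ≤ᴵ w → u ≤[ 1ℚ - value r ] v) → u ≤ᴵ w I.⇒ v
  ⇒-limit em {u} {v} w u≤v {q} q∈ =
    let q′ , q<q′ , q′∈ = rounded u q∈
        ε , 0<ε , q′≡ = fifth q<q′
        r , r≤w , r+ε∉ = approximateᵘ em w 0<ε
    in ≤1 u q∈ , 1ℚ - (value r + ε) - ε , q′ - (1ℚ - value r) ,
      (value r + ε , r+ε∉ ,
        <-by ε 0<ε (solve 2 (λ r ε → con 1ℚ :- (r :+ ε) := con 1ℚ :- (r :+ ε) :- ε :+ ε) refl (value r) ε)) ,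
      u≤v r r≤w q′∈ ,
      <-by (ε + ε + ε) (0<+ (0<+ 0<ε 0<ε) 0<ε)
        (trans (cong (λ z → 1ℚ - (value r + ε) - ε + (z - (1ℚ - value r))) q′≡)
          (solve 3 (λ q r ε → con 1ℚ :- (r :+ ε) :- ε :+ (q :+ (ε :+ ε :+ ε :+ ε :+ ε) :- (con 1ℚ :- r))
            := q :+ (ε :+ ε :+ ε)) refl q (value r) ε))

-- Order and constants seen through the values at maximal filters.

module FilterValues {c ℓ} (em : ExcludedMiddle (suc (c ⊔ ℓ))) (A : PavelkaAlgebra c ℓ) where
  open PavelkaAlgebra A
  open MVProperties reduct
  private
    module I = RawPavelkaAlgebra ([0,1]-raw (suc (c ⊔ ℓ)))
    module Std (F : SpecM A) where
      open Quotient A F public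
      open StandardEmbedding quotient em quotient-nontrivial
        (quotient-archimedean (lower-em (suc (c ⊔ ℓ)) em)) public

  n : Carrier → SpecM A → [0,1] (suc (c ⊔ ℓ))
  n = naturalEmbedding em A

  n-mono : ∀ {x y} → x ≤ y → ∀ F → n x F ≤ᴵ n y F
  n-mono x≤y F = Std.mono F (Std.≈⇒≈F F x≤y)

  n-const : ∀ r F → n (const r) F ≈ᴵ constᴵ r
  n-const r F = Std.const-homo F r

  n-⇒ : ∀ x y F → n (x ⇒ y) F ≈ᴵ n x F I.⇒ n y F
  n-⇒ x y F = Std.⇒-homo F (Std.isMVHomomorphism F) x y

  n-1 : ∀ F → n 1# F ≈ᴵ I.1#
  n-1 F = Std.1-homo F (Std.isMVHomomorphism F)

  -- The order of A/F is total; if y ≤ x there, the two values coincide and the embedding of A/F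
  -- reflects this.
  n-reflects-≤ : ∀ {x y} F → n x F ≤ᴵ n y F → (x ⇒ y) ∈ MaximalFilter.filter F
  n-reflects-≤ {x} {y} F nx≤ny with Std.total F x y
  ... | inj₁ x≤y = Std.≈F1⇒∈ F x≤y
  ... | inj₂ y≤x = Std.≈F1⇒∈ F (Std.reflects-≤ F (Std.isMVHomomorphism F) ⟨ nx≤ny , Std.mono F y≤x ⟩)

  n-⇒-const : ∀ r y F → n (const r ⇒ y) F ≈ᴵ constᴵ r I.⇒ n y F
  n-⇒-const r y F = ≈ᴵ-trans (n-⇒ (const r) y F)
    (⊕ᴵ-cong (~ᴵ-cong (n-const r F)) ≈ᴵ-refl)
    where open IsEquivalence (≈ᴵ-isEquivalence {suc (c ⊔ ℓ)}) using () renaming (trans to ≈ᴵ-trans; refl to ≈ᴵ-refl)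

  n-shift : ∀ {x y} r → x · const r ≤ y → ∀ F → n x F ≤[ 1ℚ - value r ] n y F
  n-shift {x} {y} r x·r≤y F =
    ⇒-elim {u = n x F} {v = n y F} r (≈⇒⊆ (n-⇒-const r y F) ∘ n-mono (residual x·r≤y) F)

  module _ (semisimple : Semisimple A) where
    open SubdirectSimple semisimple

    -- Each kernel of a subdirect projection is a maximal filter containing `x ⇒ y`. So `x ⇒ y` and
    -- 1 agree in every factor, hence in `A`.
    n-reflects : ∀ {x y} → (∀ F → n x F ≤ᴵ n y F) → x ≤ y
    n-reflects {x} {y} nx≤ny = injective _ _ λ j →
      let module Bⱼ = MVProperties (B j)
          module K = Kernel reduct (B j) (homomorphism j)
          onto : ∀ b → ∃[ a ] MVAlgebra._≈_ (B j) (π j a) b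
          onto b = let a , p = surjective j b in a , p ≈-refl
          F = kernel-maximalFilter reduct (B j) (simple j) (homomorphism j) onto
      in Bⱼ.≈-trans (n-reflects-≤ F (nx≤ny F)) (Bⱼ.≈-sym K.1#-homo)

    n-unshift : ∀ {x y} r → (∀ F → n x F ≤[ 1ℚ - value r ] n y F) → x · const r ≤ y
    n-unshift {x} {y} r nx≤ny = unresidual (n-reflects λ F →
      ≈⇒⊇ (n-⇒-const r y F) ∘ ⇒-intro {u = n x F} {v = n y F} r (nx≤ny F))

-- Compatibility with constants and representation by a fuzzy context.

theorem17 :
    ∀ {c ℓ} (em : ExcludedMiddle (suc (c ⊔ ℓ))) (A : PavelkaAlgebra c ℓ) → Semisimple A →
    let open PavelkaAlgebra A
        n = naturalEmbedding em A
    in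
    ∀ (O : Carrier → Carrier) → IsClosureOperator A O →
      (∀ r x → const r · O x ≤ O (const r · x))
      ⇔
      (Σ[ G ∈ Set (suc (c ⊔ ℓ)) ] Σ[ I ∈ (SpecM A → G → [0,1] (suc (c ⊔ ℓ))) ]
        (let open FuzzyContext I in ∀ x F → n (O x) F ≈ᴵ h (d (n x)) F))
theorem17 {c} {ℓ} em A semisimple O closure = mk⇔ (λ O-· → G , I , represents O-·) λ (G , I , eq) → fuzzy G I eq
  where
  open PavelkaAlgebra A
  open MVProperties reduct
  open FilterValues em A
  open IsClosureOperator closure
  module 𝕀 = RawPavelkaAlgebra ([0,1]-raw (suc (c ⊔ ℓ)))

  -- The elements of `A` serve as attributes, lifted to the universe level of the cuts.
  G : Set (suc (c ⊔ ℓ))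
  G = Lift (suc (c ⊔ ℓ)) Carrier

  I : SpecM A → G → [0,1] (suc (c ⊔ ℓ))
  I F (lift y) = n (O y) F

  represents : (∀ r x → const r · O x ≤ O (const r · x)) →
               let open FuzzyContext I in ∀ x F → n (O x) F ≈ᴵ h (d (n x)) F
  represents O-· x F = ⟨ to , from ⟩
    where
    open FuzzyContext I
    -- The bound on `r` gives r ≤ x ⇒ O y at every maximal filter, hence r · x ≤ O y in `A`;
    -- monotonicity and idempotence then give O (r · x) ≤ O y.
    closed-bound : ∀ r y → constᴵ r ≤ᴵ d (n x) y → O x · const r ≤ O (lower y)
    closed-bound r (lift y) r≤d = ≤-trans (≤-reflexive (·-comm _ _)) (≤-trans (O-· r x)
      (≤-trans (monotone r·x≤Oy) (≤-reflexive (idempotent y))))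
      where
      r·x≤Oy : const r · x ≤ O y
      r·x≤Oy = unresidual (n-reflects semisimple λ F′ →
        ≈⇒⊇ (n-⇒ x (O y) F′) ∘ ⋀-lowerBound (λ m → n x m 𝕀.⇒ n (O y) m) F′ ∘ r≤d ∘ ≈⇒⊆ (n-const r F′))
    to : n (O x) F ≤ᴵ h (d (n x)) F
    to = ⋀-greatest (λ g → d (n x) g 𝕀.⇒ I F g) (n (O x) F) λ y →
      ⇒-limit em {u = n (O x) F} {v = I F y} (d (n x) y) λ r r≤d → n-shift r (closed-bound r y r≤d) F
    from : h (d (n x)) F ≤ᴵ n (O x) F
    -- By extensivity `x ⇒ O x` is 1, so `d (n x)` is 1 at the index `x`, and the term of the
    -- infimum there is at most `n (O x)`.
    from = 1≤⇒⇒-elim {u = d (n x) (lift x)} {v = n (O x) F}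
        (⋀-greatest (λ m → n x m 𝕀.⇒ n (O x) m) 𝕀.1# λ m →
          ≈⇒⊆ (n-⇒ x (O x) m) ∘ n-mono (≤-reflexive (≈-sym (extensive x))) m ∘ ≈⇒⊇ (n-1 m))
      ∘ ⋀-lowerBound (λ g → d (n x) g 𝕀.⇒ I F g) (lift x)

  fuzzy : (G : Set (suc (c ⊔ ℓ))) (I : SpecM A → G → [0,1] (suc (c ⊔ ℓ))) →
          (let open FuzzyContext I in ∀ x F → n (O x) F ≈ᴵ h (d (n x)) F) →
          ∀ r x → const r · O x ≤ O (const r · x)
  fuzzy G I eq r x = ≤-trans (≤-reflexive (·-comm _ _)) (n-unshift semisimple r λ F q∈ →
    ≈⇒⊇ (eq (const r · x) F) (h-shift F (≈⇒⊆ (eq x F) q∈)))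
    where
    open FuzzyContext I
    0≤1-r : 0ℚ ℚ.≤ 1ℚ - value r
    0≤1-r = 0≤- (value≤1 r)
    -- Residuation moves `n x` below `n (const r · x)`; the antitone `d` reverses this with the same
    -- shift, and `h` reverses it back.
    d-shift : ∀ g → d (n (const r · x)) g ≤[ 1ℚ - value r ] d (n x) g
    d-shift g = ⋀-shift (λ m → n (const r · x) m 𝕀.⇒ I m g) (λ m → n x m 𝕀.⇒ I m g) 0≤1-r λ m →
      ⇒-shiftˡ {u = n x m} {u′ = n (const r · x) m} {v = I m g} 0≤1-r
      (n-shift r (≤-reflexive (·-comm _ _)) m)
    h-shift : ∀ F → h (d (n x)) F ≤[ 1ℚ - value r ] h (d (n (const r · x))) F
    h-shift F = ⋀-shift (λ g → d (n x) g 𝕀.⇒ I F g) (λ g → d (n (const r · x)) g 𝕀.⇒ I F g) 0≤1-r λ g →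
      ⇒-shiftˡ {u = d (n (const r · x)) g} {u′ = d (n x) g} {v = I F g} 0≤1-r (d-shift g)
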